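{- There exist $2^{\aleph_0}$ path-minimal prime graphs whose ages are pairwise incomparable with respect to set inclusion and each well-quasi-ordered under embeddability.
   Context: Graphs are simple, undirected, loopless. A graph embeds in another if it is isomorphic to an induced subgraph. The age of a graph is the class of finite graphs embedding in it; it is well-quasi-ordered if it contains no infinite antichain. A path is a graph whose vertices can be injectively mapped into an interval of $\mathbb{Z}$ so that adjacency means images differing by $1$; its length is its number of vertices minus one. A graph $G$ is path-minimal if for every $n$ it has an induced subgraph which is a finite path of length at least $n$, and every induced subgraph of $G$ with this property embeds $G$. A module of $G=(V,E)$ is a set $A\subseteq V$ such that every $v\notin A$ is adjacent to all or to none of the vertices of $A$; $\emptyset$, singletons and $V$ are trivial modules. $G$ is prime if it has more than three vertices and all its modules are trivial. -}

module Defs where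

open import Data.Nat using (ℕ; suc; _≤_)
open import Data.Fin using (Fin; toℕ)
open import Data.Bool using (Bool; true; false)
open import Data.Product using (Σ; ∃; _×_; _,_; proj₁)
open import Data.Sum using (_⊎_)
open import Data.Empty using (⊥)
open import Relation.Nullary using (¬_)
open import Relation.Binary.PropositionalEquality using (_≡_; _≢_)

record Graph : Set₁ where
  field
    V     : Set
    E     : V → V → Bool
    sym   : ∀ u v → E u v ≡ E v u
    loopless : ∀ v → E v v ≡ false
open Graph public

record _↪_ (G H : Graph) : Set where
  field
    map  : V G → V H
    inj  : ∀ u v → map u ≡ map v → u ≡ v
    pres : ∀ u v → E H (map u) (map v) ≡ E G u v
open _↪_ public

Induced : (G : Graph) → (V G → Set) → Graph
Induced G S = record
  { V = Σ (V G) S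
  ; E = λ u v → E G (proj₁ u) (proj₁ v)
  ; sym = λ u v → sym G (proj₁ u) (proj₁ v)
  ; loopless = λ v → loopless G (proj₁ v)
  }

record FinGraph (n : ℕ) : Set where
  field
    adj  : Fin n → Fin n → Bool
    adj-sym : ∀ i j → adj i j ≡ adj j i
    adj-loopless : ∀ i → adj i i ≡ false

finToGraph : ∀ {n} → FinGraph n → Graph
finToGraph {n} F = record
  { V = Fin n ; E = FinGraph.adj F
  ; sym = FinGraph.adj-sym F ; loopless = FinGraph.adj-loopless F }

InAge : ∀ {n} → FinGraph n → Graph → Set
InAge F G = finToGraph F ↪ G

AgeSubset : Graph → Graph → Set
AgeSubset G H = ∀ n (F : FinGraph n) → InAge F G → InAge F H

AgeWQO : Graph → Set
AgeWQO G =
  ¬ (Σ (ℕ → Σ ℕ FinGraph) λ A →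
       (∀ i → InAge (Data.Product.proj₂ (A i)) G) ×
       (∀ i j → i ≢ j → ¬ (finToGraph (Data.Product.proj₂ (A i)) ↪
                           finToGraph (Data.Product.proj₂ (A j)))))

pathAdj : ∀ {m} → Fin (suc m) → Fin (suc m) → Set
pathAdj i j = (toℕ j ≡ suc (toℕ i)) ⊎ (toℕ i ≡ suc (toℕ j))

record Path (m : ℕ) : Set where
  field
    graph : FinGraph (suc m)
    adj-spec : ∀ i j → (FinGraph.adj graph i j ≡ true → pathAdj i j)
                     × (pathAdj i j → FinGraph.adj graph i j ≡ true)

HasLongPaths : Graph → Set
HasLongPaths G = ∀ n → Σ ℕ λ m → n ≤ m × Σ (Path m) λ P →
                   finToGraph (Path.graph P) ↪ G

PathMinimal : Graph → Set₁
PathMinimal G = HasLongPaths G ×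
  (∀ (S : V G → Set) → HasLongPaths (Induced G S) → G ↪ Induced G S)

-- Modules (stated negatively, classically equivalent to the paper's
-- "adjacent to all or none"): no outside vertex distinguishes two members.
IsModule : (G : Graph) → (V G → Set) → Set
IsModule G A = ∀ v → ¬ A v → ∀ a b → A a → A b →
               ¬ (E G v a ≡ true × E G v b ≡ false)

NonTrivial : (G : Graph) → (V G → Set) → Set
NonTrivial G A = (Σ (V G) λ a → Σ (V G) λ b → A a × A b × a ≢ b)
               × (Σ (V G) λ c → ¬ A c)

Prime : Graph → Set₁
Prime G = (Σ (Fin 4 → V G) λ f → ∀ i j → f i ≡ f j → i ≡ j)
        × (∀ (A : V G → Set) → IsModule G A → ¬ NonTrivial G A)

{-# OPTIONS --safe #-}
-- A sequence a is coded by a Toeplitz word u over {0, 1}, which is uniformly recurrent and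
-- whose factors determine a. The graph of a is the sum of the finite paths reading the
-- prefixes of u, where vertices of two different paths are adjacent when both carry 1.
-- A long induced path cannot cross between components, because the edge where it does
-- leaves only the letter 0 to all vertices further on, and u has no long run of 0.
-- So a subset with long paths contains long intervals of components, where by recurrence
-- all prefixes of u are read: path-minimality. A long path together with one vertex of
-- another component displays its word, so the age determines u up to reversal.
-- A member of the age is a list of lists of factors of u; factors are well-quasi-ordered
-- by recurrence and Higman's lemma, applied twice, does the rest.
module Submission where

open import Defs
open import Data.Nat using (ℕ; zero; suc; _+_; _*_; _∸_; _^_; _⊓_; _⊔_; _≤_; _<_; z≤n; s≤s; NonZero; _≟_; _≤?_)
open import Data.Nat.Properties hiding (_≟_; _≤?_)
open import Data.Nat.DivMod using (_/_; _%_; m≡m%n+[m/n]*n; m%n<n)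
open import Data.Nat.Binary using (ℕᵇ; zero; 2[1+_]; 1+[2_]; fromℕ')
open import Data.Nat.Tactic.RingSolver using (solve-∀)
open import Data.Bool using (Bool; true; false; _∧_; if_then_else_)
open import Data.Bool.Properties using (∧-comm; ∧-zeroʳ; ⇔→≡)
import Data.Bool.Properties as Bool
open import Data.Product using (Σ; ∃; ∃₂; _×_; _,_; proj₁; proj₂)
open import Data.Product.Properties using (≡-dec)
open import Data.Product.Relation.Binary.Pointwise.NonDependent using (×-decidable) renaming (Pointwise to _⊗_)
open import Data.Sum using (_⊎_; inj₁; inj₂; [_,_]′; swap) renaming (map to map-⊎)
open import Data.Sum.Relation.Binary.Pointwise using (inj₁; inj₂) renaming (Pointwise to _⊕_)
open import Data.Empty using (⊥)
open import Data.Fin using (Fin; toℕ; fromℕ<) renaming (zero to fzero; suc to fsuc)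
open import Data.Fin.Properties using (toℕ-fromℕ<; toℕ-injective; toℕ<n; any?)
open import Data.List using (List; []; _∷_; _++_; length)
open import Data.List.Relation.Unary.All using (All; []; _∷_)
open import Data.List.Relation.Unary.Any using (Any; here; there)
open import Data.List.Relation.Binary.Sublist.Heterogeneous using (Sublist; []; _∷_; _∷ʳ_; minimum)
open import Data.List.Relation.Binary.Sublist.Heterogeneous.Properties using (sublist?; ++⁺; ++ˡ)
open import Function using (id; _∘_)
open import Function.Bundles using (mk⇔)
open import Relation.Nullary using (¬_; Dec; yes; no; contradiction; does)
open import Relation.Nullary.Decidable using (_⊎-dec_; _×-dec_; dec-true; dec-false; does-⇔)
open import Relation.Binary.Definitions using (Decidable; tri<; tri≈; tri>)
open import Relation.Binary.PropositionalEquality using (_≡_; _≢_; refl; trans; cong; cong₂; subst; module ≡-Reasoning)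
import Relation.Binary.PropositionalEquality as ≡

-- Almost full relations and Higman's lemma

infixl 5 _↑_
-- What remains once `x` has been drawn: a later pair `y`, `z` also counts as good when `y` was
-- already good with `x`.
_↑_ : {X : Set} → (X → X → Set) → X → (X → X → Set)
(R ↑ x) y z = R y z ⊎ R x y

↑-dec : {X : Set} {R : X → X → Set} → Decidable R → ∀ x → Decidable (R ↑ x)
↑-dec R? x y z = R? y z ⊎-dec R? x y

-- The inductive form of "every infinite sequence has i < j with R (f i) (f j)".
data AlmostFull {X : Set} (R : X → X → Set) : Set where
  now   : (∀ x y → R x y) → AlmostFull R
  later : (∀ x → AlmostFull (R ↑ x)) → AlmostFull R

af-good : {X : Set} {R : X → X → Set} → AlmostFull R → (f : ℕ → X) →
          ∃₂ λ i j → i < j × R (f i) (f j)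
af-good (now r)   f = 0 , 1 , s≤s z≤n , r _ _
af-good (later r) f with af-good (r (f 0)) (f ∘ suc)
... | i , j , i<j , inj₁ q = suc i , suc j , s≤s i<j , q
... | i , j , i<j , inj₂ q = 0 , suc i , s≤s z≤n , q

af-map : {X Y : Set} {R : X → X → Set} {S : Y → Y → Set} (f : Y → X) →
         (∀ y z → R (f y) (f z) → S y z) → AlmostFull R → AlmostFull S
af-map f h (now r)   = now λ y z → h y z (r (f y) (f z))
af-map f h (later r) = later λ x →
  af-map f (λ y z → map-⊎ (h y z) (h x y)) (r (f x))

⊕-↑-inj₁ : {X Y : Set} {R : X → X → Set} {S : Y → Y → Set} {x : X} (y z : X ⊎ Y) →
            ((R ↑ x) ⊕ S) y z → ((R ⊕ S) ↑ inj₁ x) y z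
⊕-↑-inj₁ _ _ (inj₁ (inj₁ r)) = inj₁ (inj₁ r)
⊕-↑-inj₁ _ _ (inj₁ (inj₂ r)) = inj₂ (inj₁ r)
⊕-↑-inj₁ _ _ (inj₂ s)        = inj₁ (inj₂ s)

⊕-↑-inj₂ : {X Y : Set} {R : X → X → Set} {S : Y → Y → Set} {x : Y} (y z : X ⊎ Y) →
            (R ⊕ (S ↑ x)) y z → ((R ⊕ S) ↑ inj₂ x) y z
⊕-↑-inj₂ _ _ (inj₁ r)        = inj₁ (inj₁ r)
⊕-↑-inj₂ _ _ (inj₂ (inj₁ s)) = inj₁ (inj₂ s)
⊕-↑-inj₂ _ _ (inj₂ (inj₂ s)) = inj₂ (inj₂ s)

-- A draw on one side makes only the tree of that side descend. At two leaves three draws suffice,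
-- since two of them fall on the same side.
af-⊎ : {X Y : Set} {R : X → X → Set} {S : Y → Y → Set} →
       AlmostFull R → AlmostFull S → AlmostFull (R ⊕ S)
af-⊎ {R = R} {S} (now r) (now s) = later λ x → later λ y → now λ z w → pigeonhole x y z w
  where
  pigeonhole : ∀ x y z w → ((R ⊕ S) ↑ x ↑ y) z w
  pigeonhole (inj₁ x) (inj₁ y) z        w = inj₂ (inj₂ (inj₁ (r x y)))
  pigeonhole (inj₂ x) (inj₂ y) z        w = inj₂ (inj₂ (inj₂ (s x y)))
  pigeonhole (inj₁ x) (inj₂ y) (inj₁ z) w = inj₁ (inj₂ (inj₁ (r x z)))
  pigeonhole (inj₁ x) (inj₂ y) (inj₂ z) w = inj₂ (inj₁ (inj₂ (s y z)))
  pigeonhole (inj₂ x) (inj₁ y) (inj₂ z) w = inj₁ (inj₂ (inj₂ (s x z)))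
  pigeonhole (inj₂ x) (inj₁ y) (inj₁ z) w = inj₂ (inj₁ (inj₁ (r y z)))
af-⊎ {R = R} (now r) (later s) = later λ where
  -- A draw on the side of `now r` shrinks nothing, so a second one is awaited: on the same side it
  -- is good with the first, on the other side `later s` descends.
  (inj₁ x) → later λ where
    (inj₁ y) → now λ z w → inj₂ (inj₂ (inj₁ (r x y)))
    (inj₂ y) → af-map id (λ z w → map-⊎ inj₁ inj₁ ∘ ⊕-↑-inj₂ z w) (af-⊎ {R = R} (now r) (s y))
  (inj₂ y) → af-map id ⊕-↑-inj₂ (af-⊎ {R = R} (now r) (s y))
af-⊎ {S = S} (later r) (now s) = later λ where
  (inj₁ x) → af-map id ⊕-↑-inj₁ (af-⊎ {S = S} (r x) (now s))
  (inj₂ y) → later λ where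
    (inj₁ x) → af-map id (λ z w → map-⊎ inj₁ inj₁ ∘ ⊕-↑-inj₁ z w) (af-⊎ {S = S} (r x) (now s))
    (inj₂ z) → now λ _ _ → inj₂ (inj₂ (inj₂ (s y z)))
af-⊎ (later r) (later s) = later λ where
  (inj₁ x) → af-map id ⊕-↑-inj₁ (af-⊎ (r x) (later s))
  (inj₂ y) → af-map id ⊕-↑-inj₂ (af-⊎ (later r) (s y))

-- The pairs not above (a , b) are split according to a coordinate in which they fail
-- to be above; R being decidable, this is a function.
af-× : {X Y : Set} {R : X → X → Set} {S : Y → Y → Set} → Decidable R → Decidable S →
       AlmostFull R → AlmostFull S → AlmostFull (R ⊗ S)
af-× R? S? (now r) s = af-map proj₂ (λ _ _ q → r _ _ , q) s
af-× R? S? (later r) (now s) = af-map proj₁ (λ _ _ q → q , s _ _) (later r)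
af-× {X} {Y} {R} {S} R? S? (later r) (later s) = later λ (a , b) →
  af-map (λ p → side a p (R? a (proj₁ p)))
         (λ p q → sound a b p q (R? a (proj₁ p)) (R? a (proj₁ q)))
         (af-⊎ (af-× (↑-dec R? a) S? (r a) (later s)) (af-× R? (↑-dec S? b) (later r) (s b)))
  where
  side : ∀ a (p : X × Y) → Dec (R a (proj₁ p)) → (X × Y) ⊎ (X × Y)
  side a p (yes _) = inj₂ p
  side a p (no _)  = inj₁ p
  sound : ∀ a b p q (d : Dec (R a (proj₁ p))) (e : Dec (R a (proj₁ q))) →
          (((R ↑ a) ⊗ S) ⊕ (R ⊗ (S ↑ b))) (side a p d) (side a q e) → ((R ⊗ S) ↑ (a , b)) p q
  sound a b p q (no ¬r) (no _) (inj₁ (inj₁ r , s)) = inj₁ (r , s)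
  sound a b p q (no ¬r) (no _) (inj₁ (inj₂ r , s)) = contradiction r ¬r
  sound a b p q (yes ρ) (yes _) (inj₂ (r , inj₁ s)) = inj₁ (r , s)
  -- `(a , b)` and `p` are already good: `ρ` put `p` on this side, and `s` supplies the second
  -- coordinate.
  sound a b p q (yes ρ) (yes _) (inj₂ (r , inj₂ s)) = inj₂ (ρ , s)

af-≤ : AlmostFull _≤_
af-≤ = later above
  where
  above : ∀ n → AlmostFull (_≤_ ↑ n)
  above zero    = now λ _ _ → inj₂ z≤n
  above (suc n) = later λ m → step m (m ≤? n)
    where
    step : ∀ m → Dec (m ≤ n) → AlmostFull (_≤_ ↑ suc n ↑ m)
    step m (yes m≤n) = af-map id
      (λ _ _ → map-⊎ inj₁ (λ n≤y → inj₁ (≤-trans m≤n n≤y))) (above n)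
    step m (no m≰n) = now λ _ _ → inj₂ (inj₂ (≰⇒> m≰n))

af-Bool : AlmostFull {Bool} _≡_
af-Bool = later λ x → later λ y → now λ z w → pigeonhole x y z w
  where
  pigeonhole : ∀ x y z w → (_≡_ ↑ x ↑ y) z w
  pigeonhole false false z     w = inj₂ (inj₂ refl)
  pigeonhole true  true  z     w = inj₂ (inj₂ refl)
  pigeonhole false true  false w = inj₁ (inj₂ refl)
  pigeonhole false true  true  w = inj₂ (inj₁ refl)
  pigeonhole true  false true  w = inj₁ (inj₂ refl)
  pigeonhole true  false false w = inj₂ (inj₁ refl)

-- A list not above a ∷ w either has no entry above a, or splits at its first such
-- entry b into us ++ b ∷ vs with vs not above w. So the lists not above a ∷ w are
-- covered by an alphabet avoiding a and by a product with a shorter w.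
module _ {X : Set} {R : X → X → Set} (R? : Decidable R) where

  data Split (a : X) : List X → Set where
    free : ∀ {v} → All (λ x → ¬ R a x) v → Split a v
    hit  : ∀ {us b vs} → All (λ x → ¬ R a x) us → R a b → Split a (us ++ b ∷ vs)

  split : ∀ a v → Split a v
  split a [] = free []
  split a (x ∷ v) with R? a x | split a v
  ... | yes r | _         = hit [] r
  ... | no ¬r | free ¬rs  = free (¬r ∷ ¬rs)
  ... | no ¬r | hit ¬rs r = hit (¬r ∷ ¬rs) r

  Cover : Set
  Cover = List X ⊎ (List X × X × List X)

  pieces : ∀ {a v} → Split a v → Cover
  pieces {v = v} (free _)                = inj₁ v
  pieces (hit {us = us} {b} {vs} _ _) = inj₂ (us , b , vs)

  -- The additional alternative of `R ↑ a` says that the left letter is above `a`, which `All`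
  -- excludes.
  sublist-free : ∀ {a us vs} → All (λ x → ¬ R a x) us → Sublist (R ↑ a) us vs → Sublist R us vs
  sublist-free ¬rs        []             = []
  sublist-free ¬rs        (y ∷ʳ p)       = y ∷ʳ sublist-free ¬rs p
  sublist-free (¬r ∷ ¬rs) (inj₁ r ∷ p)   = r ∷ sublist-free ¬rs p
  sublist-free (¬r ∷ ¬rs) (inj₂ r ∷ p)   = contradiction r ¬r

  pieces-sound : ∀ {a w v v′} (s : Split a v) (s′ : Split a v′) →
    (Sublist (R ↑ a) ⊕ (Sublist (R ↑ a) ⊗ (R ⊗ (Sublist R ↑ w)))) (pieces s) (pieces s′) →
    (Sublist R ↑ (a ∷ w)) v v′
  pieces-sound (free ¬rs) (free _) (inj₁ p) = inj₁ (sublist-free ¬rs p)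
  pieces-sound (hit ¬rs _) (hit _ _) (inj₂ (p , r , inj₁ q)) =
    inj₁ (++⁺ (sublist-free ¬rs p) (r ∷ q))
  pieces-sound (hit {us = us} _ r) (hit _ _) (inj₂ (_ , _ , inj₂ q)) = inj₂ (++ˡ us (r ∷ q))

sublist-full : {X : Set} {R : X → X → Set} → (∀ x y → R x y) →
               ∀ us vs → length us ≤ length vs → Sublist R us vs
sublist-full r []       vs       _       = minimum vs
sublist-full r (u ∷ us) (v ∷ vs) (s≤s p) = r u v ∷ sublist-full r us vs p

-- If all letters are comparable, lengths decide. Otherwise `avoid` goes by induction on the first
-- word drawn: words without a letter above `a` are compared by `R ↑ a`, whose tree `r a` is
-- smaller.
higman : {X : Set} {R : X → X → Set} → Decidable R → AlmostFull R → AlmostFull (Sublist R)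
higman R? (now r) = af-map length (sublist-full r) af-≤
higman {X} {R} R? (later r) = later avoid
  where
  avoid : ∀ w → AlmostFull (Sublist R ↑ w)
  avoid []      = now λ v _ → inj₂ (minimum v)
  avoid (a ∷ w) = af-map (λ v → pieces R? (split R? a v))
    (λ v v′ → pieces-sound R? (split R? a v) (split R? a v′))
    (af-⊎ (higman (↑-dec R? a) (r a))
          (af-× (sublist? (↑-dec R? a)) (×-decidable R? (↑-dec (sublist? R?) w))
                (higman (↑-dec R? a) (r a))
                (af-× R? (↑-dec (sublist? R?) w) (later r) (avoid w))))

-- Toeplitz words

data Parity : ℕ → Set where
  even : ∀ q → Parity (q + q)
  odd  : ∀ q → Parity (suc (q + q))

parity : ∀ x → Parity x
parity zero = even 0
parity (suc x) with parity x
... | even q = odd q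
... | odd q  = subst Parity (cong suc (+-suc q q)) (even (suc q))

-- The Toeplitz word of β: the letter at x is β ν, where 2 ^ ν is the largest power of 2
-- dividing x + 1.
letter : (ℕ → Bool) → ℕᵇ → Bool
letter β zero     = β 0
letter β 2[1+ _ ] = β 0
letter β 1+[2 x ] = letter (β ∘ suc) x

toeplitz : (ℕ → Bool) → ℕ → Bool
toeplitz β x = letter β (fromℕ' x)

fromℕ'-odd : ∀ q → fromℕ' (suc (q + q)) ≡ 1+[2 fromℕ' q ]
fromℕ'-odd zero = refl
fromℕ'-odd (suc q) rewrite +-suc q q | fromℕ'-odd q = refl

toeplitz-even : ∀ β q → toeplitz β (q + q) ≡ β 0
toeplitz-even β zero = refl
toeplitz-even β (suc q) rewrite +-suc q q | fromℕ'-odd q = refl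

toeplitz-odd : ∀ β q → toeplitz β (suc (q + q)) ≡ toeplitz (β ∘ suc) q
toeplitz-odd β q rewrite fromℕ'-odd q = refl

half-< : ∀ {q r} → q + q < r + r → q < r
half-< {q} {r} p = ≰⇒> (λ r≤q → <⇒≱ p (+-mono-≤ r≤q r≤q))

2^suc : ∀ m → 2 ^ suc m ≡ 2 ^ m + 2 ^ m
2^suc m = cong (2 ^ m +_) (+-identityʳ (2 ^ m))

-- Adding a multiple of `2 ^ m` keeps the 2-adic valuation of `x + 1`, as `0 < x + 1 < 2 ^ m`. At
-- the position `2 ^ m - 1` the letter may vary with `t`.
toeplitz-periodic : ∀ m β x t → suc x < 2 ^ m → toeplitz β (x + t * 2 ^ m) ≡ toeplitz β x
toeplitz-periodic zero β x t (s≤s ())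
toeplitz-periodic (suc m) β x t p with parity x
... | even q = trans (cong (toeplitz β) (lemma q t (2 ^ m)))
                     (trans (toeplitz-even β (q + t * 2 ^ m)) (≡.sym (toeplitz-even β q)))
  where
  lemma : ∀ q t n → q + q + t * (n + (n + 0)) ≡ (q + t * n) + (q + t * n)
  lemma = solve-∀
... | odd q = trans (cong (toeplitz β) (lemma q t (2 ^ m)))
  (trans (toeplitz-odd β (q + t * 2 ^ m))
  (trans (toeplitz-periodic m (β ∘ suc) q t
           (half-< (subst (_≤ 2 ^ m + 2 ^ m) (cong (suc ∘ suc) (≡.sym (+-suc q q)))
             (subst (suc (suc (suc (q + q))) ≤_) (2^suc m) p))))
  (≡.sym (toeplitz-odd β q))))
  where
  lemma : ∀ q t n → suc (q + q) + t * (n + (n + 0)) ≡ suc ((q + t * n) + (q + t * n))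
  lemma = solve-∀

-- Since -z and z have the same 2-adic valuation, the word read backwards
-- from 2 ^ m - 2 is again the word.
toeplitz-palindrome : ∀ m β x y → 2 + (x + y) ≡ 2 ^ m → toeplitz β x ≡ toeplitz β y
toeplitz-palindrome zero β x y ()
toeplitz-palindrome (suc m) β x y p with parity x | parity y
... | even q | even r = trans (toeplitz-even β q) (≡.sym (toeplitz-even β r))
... | odd q  | odd r  = trans (toeplitz-odd β q) (trans
  (toeplitz-palindrome m (β ∘ suc) q r (*-cancelˡ-≡ _ _ 2 (trans (lemma q r) p)))
  (≡.sym (toeplitz-odd β r)))
  where
  lemma : ∀ q r → 2 * (2 + (q + r)) ≡ 2 + (suc (q + q) + suc (r + r))
  lemma = solve-∀
... | even q | odd r = contradiction (trans (≡.sym p) (lemma q r)) (even≢odd (2 ^ m) (suc (q + r)))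
  where
  lemma : ∀ q r → 2 + (q + q + suc (r + r)) ≡ suc (2 * suc (q + r))
  lemma = solve-∀
... | odd q | even r = contradiction (trans (≡.sym p) (lemma q r)) (even≢odd (2 ^ m) (suc (q + r)))
  where
  lemma : ∀ q r → 2 + (suc (q + q) + (r + r)) ≡ suc (2 * suc (q + r))
  lemma = solve-∀

-- Level `j` fills an arithmetic progression of difference `2 ^ suc j`, which meets every block of
-- that length.
toeplitz-hits : ∀ j β y → ∃ λ o → o < 2 ^ suc j × toeplitz β (y + o) ≡ β j
toeplitz-hits j β y with parity y
toeplitz-hits zero    β _ | even q = 0 , s≤s z≤n ,
  trans (cong (toeplitz β) (+-identityʳ (q + q))) (toeplitz-even β q)
toeplitz-hits zero    β _ | odd q  = 1 , s≤s (s≤s z≤n) ,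
  trans (cong (toeplitz β) (lemma q)) (toeplitz-even β (suc q))
  where
  lemma : ∀ q → suc (q + q) + 1 ≡ suc q + suc q
  lemma = solve-∀
toeplitz-hits (suc j) β _ | even q with toeplitz-hits j (β ∘ suc) q
... | o , o< , eq = suc (o + o) ,
  small (+-mono-≤ o< o<) ,
  trans (cong (toeplitz β) (lemma q o)) (trans (toeplitz-odd β (q + o)) eq)
  where
  lemma : ∀ q o → q + q + suc (o + o) ≡ suc ((q + o) + (q + o))
  lemma = solve-∀
  small : suc o + suc o ≤ 2 ^ suc j + 2 ^ suc j → suc (o + o) < 2 ^ suc (suc j)
  small p rewrite 2^suc (suc j) = subst (_≤ 2 ^ suc j + 2 ^ suc j) (cong suc (+-suc o o)) p
toeplitz-hits (suc j) β _ | odd q with toeplitz-hits j (β ∘ suc) q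
... | o , o< , eq = o + o ,
  subst (o + o <_) (≡.sym (2^suc (suc j))) (+-mono-< o< o<) ,
  trans (cong (toeplitz β) (lemma q o)) (trans (toeplitz-odd β (q + o)) eq)
  where
  lemma : ∀ q o → suc (q + q) + (o + o) ≡ suc ((q + o) + (q + o))
  lemma = solve-∀

n<2^n : ∀ n → n < 2 ^ n
n<2^n zero    = s≤s z≤n
n<2^n (suc n) = subst (suc n <_) (≡.sym (2^suc n)) (+-mono-≤-< (≤-trans (s≤s z≤n) (n<2^n n)) (n<2^n n))

-- Every multiple of `2 ^ (2 + n)` starts a copy of the prefix, and one lies at most that far ahead;
-- `n` further positions complete the copy.
window : ℕ → ℕ
window n = 2 ^ (2 + n) + n

toeplitz-window : ∀ β n y → ∃ λ o → o + n ≤ window n ×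
  (∀ i → i ≤ n → toeplitz β (y + (o + i)) ≡ toeplitz β i)
toeplitz-window β n y = o , +-monoˡ-≤ n (m∸n≤m M (y % M)) , λ i i≤n →
  trans (cong (toeplitz β) (position i))
        (toeplitz-periodic (2 + n) β i (suc (y / M))
          (≤-trans (s≤s (s≤s i≤n)) (<⇒≤ (n<2^n (2 + n)))))
  where
  M = 2 ^ (2 + n)
  instance
    M≢0 : NonZero M
    M≢0 = m^n≢0 2 (2 + n)
  -- At a multiple of `M` this is `M` and not 0, so the copy starts at `suc (y / M) * M` in all
  -- cases.
  o = M ∸ y % M
  position : ∀ i → y + (o + i) ≡ i + suc (y / M) * M
  position i = begin
    y + (o + i)                        ≡⟨ cong (_+ (o + i)) (m≡m%n+[m/n]*n y M) ⟩
    y % M + y / M * M + (o + i)        ≡⟨ lemma (y % M) (y / M * M) o i ⟩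
    i + (y % M + o + y / M * M)        ≡⟨ cong (λ z → i + (z + y / M * M)) (m+[n∸m]≡n (<⇒≤ (m%n<n y M))) ⟩
    i + suc (y / M) * M                ∎
    where
    open ≡-Reasoning
    lemma : ∀ a b c d → a + b + (c + d) ≡ d + (a + c + b)
    lemma = solve-∀

-- Uniform recurrence, stated for prefixes only, since every factor lies in a prefix.
Recurrent : (ℕ → Bool) → Set
Recurrent u = ∀ n → ∃ λ N → ∀ y → ∃ λ o → o + n ≤ N × (∀ i → i ≤ n → u (y + (o + i)) ≡ u i)

toeplitz-recurrent : ∀ β → Recurrent (toeplitz β)
toeplitz-recurrent β n = window n , toeplitz-window β n

-- Recovering the levels from the factors

Occurs : (ℕ → Bool) → (ℕ → Bool) → Set
Occurs u v = ∀ n → ∃ λ y → ∀ i → i ≤ n → u i ≡ v (y + i)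

Unsteady : (ℕ → Bool) → Set
Unsteady β = ∀ k → ¬ (β k ≡ β (1 + k) × β (1 + k) ≡ β (2 + k))

-- The parity of an occurrence of a long prefix is forced to be even: at an odd place
-- the constant letter β 0 would occupy a whole window of the word of β′ ∘ suc.
desubstitute : ∀ β β′ → Unsteady β′ → Occurs (toeplitz β) (toeplitz β′) →
  β 0 ≡ β′ 0 × Occurs (toeplitz (β ∘ suc)) (toeplitz (β′ ∘ suc))
desubstitute β β′ unsteady occ = proj₁ (shift 0) , λ n → proj₂ (shift n)
  where
  shift : ∀ n → β 0 ≡ β′ 0 × ∃ λ y → ∀ i → i ≤ n → toeplitz (β ∘ suc) i ≡ toeplitz (β′ ∘ suc) (y + i)
  -- At an odd place, the even positions up to 14 display eight consecutive letters of the word of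
  -- `β′ ∘ suc`, enough to meet its levels 0, 1 and 2. At an even place, `suc (n + n)` is the last
  -- position read.
  shift n with occ (14 + suc (n + n))
  ... | z , eq with parity z
  ... | even y = trans (eq 0 z≤n) (trans (cong (toeplitz β′) (+-identityʳ (y + y))) (toeplitz-even β′ y)) ,
    y , λ i i≤n → trans (≡.sym (toeplitz-odd β i))
      (trans (eq (suc (i + i)) (m≤n⇒m≤o+n 14 (s≤s (+-mono-≤ i≤n i≤n))))
      (trans (cong (toeplitz β′) (lemma y i)) (toeplitz-odd β′ (y + i))))
    where
    lemma : ∀ y i → y + y + suc (i + i) ≡ suc ((y + i) + (y + i))
    lemma = solve-∀
  ... | odd y = contradiction (trans (≡.sym (value 0 (s≤s (s≤s z≤n)))) (value 1 (s≤s (s≤s (s≤s (s≤s z≤n))))) ,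
                               trans (≡.sym (value 1 (s≤s (s≤s (s≤s (s≤s z≤n)))))) (value 2 ≤-refl)) (unsteady 1)
    where
    lemma : ∀ y i → suc (y + y) + (i + i) ≡ suc ((y + i) + (y + i))
    lemma = solve-∀
    constant : ∀ i → i ≤ 7 → β 0 ≡ toeplitz (β′ ∘ suc) (y + i)
    constant i i≤7 = trans (≡.sym (toeplitz-even β i))
      (trans (eq (i + i) (m≤n⇒m≤n+o (suc (n + n)) (+-mono-≤ i≤7 i≤7)))
      (trans (cong (toeplitz β′) (lemma y i)) (toeplitz-odd β′ (y + i))))
    value : ∀ j → 2 ^ suc j ≤ 8 → β 0 ≡ β′ (suc j)
    value j j≤ with toeplitz-hits j (β′ ∘ suc) y
    ... | o , o< , found = trans (constant o (≤-pred (≤-trans o< j≤))) found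

occurs⇒≗ : ∀ k β β′ → Unsteady β′ → Occurs (toeplitz β) (toeplitz β′) → β k ≡ β′ k
occurs⇒≗ zero    β β′ uns occ = proj₁ (desubstitute β β′ uns occ)
occurs⇒≗ (suc k) β β′ uns occ =
  occurs⇒≗ k (β ∘ suc) (β′ ∘ suc) (uns ∘ suc) (proj₂ (desubstitute β β′ uns occ))

-- The prefix of `2 ^ m - 1` letters is a palindrome, so its reflection carries a factor to its
-- reversal. The exponent chosen makes this prefix long enough.
reverse-occurrence : ∀ β y n → ∃ λ y′ → ∀ i x → i ≤ n → x + i ≡ y + n →
  toeplitz β x ≡ toeplitz β (y′ + i)
reverse-occurrence β y n = M ∸ (2 + (y + n)) , λ i x i≤n eq →
  toeplitz-palindrome (2 + (y + n)) β x (M ∸ (2 + (y + n)) + i) (begin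
    2 + (x + (M ∸ (2 + (y + n)) + i))   ≡⟨ lemma x (M ∸ (2 + (y + n))) i ⟩
    (2 + (x + i)) + (M ∸ (2 + (y + n))) ≡⟨ cong (λ z → 2 + z + (M ∸ (2 + (y + n)))) eq ⟩
    (2 + (y + n)) + (M ∸ (2 + (y + n))) ≡⟨ m+[n∸m]≡n (<⇒≤ (n<2^n (2 + (y + n)))) ⟩
    M ∎)
  where
  open ≡-Reasoning
  M = 2 ^ (2 + (y + n))
  lemma : ∀ x a i → 2 + (x + (a + i)) ≡ 2 + (x + i) + a
  lemma = solve-∀

-- The levels 3k and 3k + 1 carry fixed letters and level 3k + 2 carries a k.
levels : (ℕ → Bool) → ℕ → Bool
levels a 0 = false
levels a 1 = true
levels a 2 = a 0
levels a (suc (suc (suc k))) = levels (a ∘ suc) k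

-- Any three consecutive levels include both fixed letters.
levels-unsteady : ∀ a → Unsteady (levels a)
levels-unsteady a 0 (() , _)
levels-unsteady a 1 (p , q) with () ← trans p q
levels-unsteady a 2 (_ , ())
levels-unsteady a (suc (suc (suc k))) = levels-unsteady (a ∘ suc) k

levels-2+3k : ∀ a k → levels a (2 + k * 3) ≡ a k
levels-2+3k a zero    = refl
levels-2+3k a (suc k) = levels-2+3k (a ∘ suc) k

-- Induced paths

Near : ℕ → ℕ → Set
Near i j = (j ≡ suc i) ⊎ (i ≡ suc j)

near? : ∀ i j → Dec (Near i j)
near? i j = (j ≟ suc i) ⊎-dec (i ≟ suc j)

near : ℕ → ℕ → Bool
near i j = does (near? i j)

near-true : ∀ {i j} → Near i j → near i j ≡ true
near-true {i} {j} = dec-true (near? i j)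

near-false : ∀ {i j} → ¬ Near i j → near i j ≡ false
near-false {i} {j} = dec-false (near? i j)

near-true⁻¹ : ∀ {i j} → near i j ≡ true → Near i j
near-true⁻¹ {i} {j} p with near? i j
... | yes n = n
... | no ¬n with () ← trans (≡.sym p) (near-false ¬n)

near-false-far : ∀ {i j} → suc i < j → near i j ≡ false
near-false-far {i} {j} p = near-false {i} {j} λ where
  (inj₁ refl) → <-irrefl refl p
  (inj₂ refl) → <-asym p (m<n⇒m<1+n (n<1+n _))

near-irrefl : ∀ i → near i i ≡ false
near-irrefl i = near-false {i} {i} [ 1+n≢n ∘ ≡.sym , 1+n≢n ∘ ≡.sym ]′

near-shift : ∀ s i j → near (s + i) (s + j) ≡ near i j
near-shift zero    i j = refl
near-shift (suc s) i j = near-shift s i j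

near-sym : ∀ i j → near i j ≡ near j i
near-sym i j = does-⇔ (mk⇔ swap swap) (near? i j) (near? j i)

-- A vertex (k , i) is the position i of the component k, and carries the letter u i.
cellE : (ℕ → Bool) → ℕ × ℕ → ℕ × ℕ → Bool
cellE u (k , i) (l , j) = if does (k ≟ l) then near i j else (u i ∧ u j)

module _ (u : ℕ → Bool) where

  cellE-same : ∀ k {i j} → cellE u (k , i) (k , j) ≡ near i j
  cellE-same k rewrite dec-true (k ≟ k) refl = refl

  cellE-diff : ∀ {k l} i j → k ≢ l → cellE u (k , i) (l , j) ≡ u i ∧ u j
  cellE-diff {k} {l} i j k≢l rewrite dec-false (k ≟ l) k≢l = refl

  grid : Graph
  grid = record { V = ℕ × ℕ ; E = cellE u ; sym = symmetric ; loopless = irreflexive }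
    where
    symmetric : ∀ v w → cellE u v w ≡ cellE u w v
    symmetric (k , i) (l , j) with k ≟ l
    ... | yes refl = trans (cellE-same k {i} {j}) (trans (near-sym i j) (≡.sym (cellE-same k {j} {i})))
    ... | no k≢l   = trans (cellE-diff i j k≢l)
      (trans (∧-comm (u i) (u j)) (≡.sym (cellE-diff j i (k≢l ∘ ≡.sym))))
    irreflexive : ∀ v → cellE u v v ≡ false
    irreflexive (k , i) = trans (cellE-same k {i} {i}) (near-irrefl i)

Straight : (ℕ → ℕ) → ℕ → Set
Straight p n = (∀ s → s ≤ n → p s ≡ p 0 + s) ⊎ (∀ s → s ≤ n → p s + s ≡ p 0)

-- The first step fixes the direction: a step reversing it would return to the position two steps
-- before.
straight : ∀ (p : ℕ → ℕ) n → (∀ s → s < n → Near (p s) (p (suc s))) →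
           (∀ s → suc s < n → p s ≢ p (suc (suc s))) → Straight p n
straight p zero    nr nb = inj₁ λ { zero z≤n → ≡.sym (+-identityʳ (p 0)) }
straight p (suc n) nr nb = map-⊎ up down (nr 0 (s≤s z≤n))
  where
  step-up : p 1 ≡ suc (p 0) → ∀ s → s < suc n → p (suc s) ≡ suc (p s)
  step-up e zero    s< = e
  step-up e (suc s) s< with nr (suc s) s<
  ... | inj₁ q = q
  ... | inj₂ q = contradiction (suc-injective (trans (≡.sym (step-up e s (<-trans (n<1+n s) s<))) q)) (nb s s<)
  step-down : p 0 ≡ suc (p 1) → ∀ s → s < suc n → p s ≡ suc (p (suc s))
  step-down e zero    s< = e
  step-down e (suc s) s< with nr (suc s) s<
  ... | inj₂ q = q
  ... | inj₁ q = contradiction (trans (step-down e s (<-trans (n<1+n s) s<)) (≡.sym q)) (nb s s<)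
  up : p 1 ≡ suc (p 0) → ∀ s → s ≤ suc n → p s ≡ p 0 + s
  up e zero    _  = ≡.sym (+-identityʳ (p 0))
  up e (suc s) s≤ = trans (step-up e s s≤)
    (trans (cong suc (up e s (<⇒≤ s≤))) (≡.sym (+-suc (p 0) s)))
  down : p 0 ≡ suc (p 1) → ∀ s → s ≤ suc n → p s + s ≡ p 0
  down e zero    _  = +-identityʳ (p 0)
  down e (suc s) s≤ = trans (+-suc (p (suc s)) s)
    (trans (cong (_+ s) (≡.sym (step-down e s s≤))) (down e s (<⇒≤ s≤)))

straight-image : ∀ p n → Straight p n → ∃ λ y → ∀ i → i ≤ n → ∃ λ s → s ≤ n × p s ≡ y + i
straight-image p n (inj₁ up)   = p 0 , λ i i≤n → i , i≤n , up i i≤n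
straight-image p n (inj₂ down) = p n , λ i i≤n → n ∸ i , m∸n≤m n i ,
  +-cancelʳ-≡ (n ∸ i) (p (n ∸ i)) (p n + i) (begin
    p (n ∸ i) + (n ∸ i) ≡⟨ down (n ∸ i) (m∸n≤m n i) ⟩
    p 0                 ≡⟨ down n ≤-refl ⟨
    p n + n             ≡⟨ cong (p n +_) (m+[n∸m]≡n i≤n) ⟨
    p n + (i + (n ∸ i)) ≡⟨ +-assoc (p n) i (n ∸ i) ⟨
    p n + i + (n ∸ i)   ∎)
  where open ≡-Reasoning

-- Only adjacency is recorded: a path in Induced G S is injective only up to the proofs of S,
-- and may a priori visit a vertex of G twice.
record PathIn (u : ℕ → Bool) (m : ℕ) (c p : ℕ → ℕ) : Set where
  constructor pathIn
  field adjacent : ∀ s t → s ≤ m → t ≤ m → cellE u (c s , p s) (c t , p t) ≡ near s t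

Dense : (ℕ → Bool) → Set
Dense u = ∀ y → ∃ λ o → o ≤ 3 × u (y + o) ≡ true

module _ {u m c p} (P : PathIn u m c p) where
  open PathIn P

  -- The path does not turn back, since its next vertex tells two vertices at distance 2 apart.
  stays⇒straight : ∀ a n → a + n < m → (∀ s → s < n → c (a + s) ≡ c (a + suc s)) →
    (∀ s → s ≤ n → c (a + s) ≡ c a) × Straight (λ s → p (a + s)) n
  stays⇒straight a n a+n<m stay =
    same , straight (λ s → p (a + s)) n
      (λ s s< → near-true⁻¹ (begin
        near (p (a + s)) (p (a + suc s)) ≡⟨ cellE-same u (c (a + s)) ⟨
        cellE u (c (a + s) , p (a + s)) (c (a + s) , p (a + suc s))
          ≡⟨ cong (λ k → cellE u (c (a + s) , p (a + s)) (k , p (a + suc s))) (stay s s<) ⟩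
        cellE u (c (a + s) , p (a + s)) (c (a + suc s) , p (a + suc s))
          ≡⟨ adjacent (a + s) (a + suc s) (bound (<⇒≤ s<)) (bound s<) ⟩
        near (a + s) (a + suc s) ≡⟨ near-true (inj₁ (+-suc a s)) ⟩
        true ∎))
      (λ s s< eq → contradiction (begin
        false ≡⟨ near-false-far {a + s} (s≤s (+-monoʳ-< a (n≤1+n (suc s)))) ⟨
        near (a + s) (suc (a + (2 + s))) ≡⟨ adjacent _ _ (bound (<⇒≤ (<⇒≤ s<))) (next s<) ⟨
        cellE u (c (a + s) , p (a + s)) (c (suc (a + (2 + s))) , p (suc (a + (2 + s))))
          ≡⟨ cong₂ (λ k i → cellE u (k , i) (c (suc (a + (2 + s))) , p (suc (a + (2 + s)))))
               (trans (same s (<⇒≤ (<⇒≤ s<))) (≡.sym (same (2 + s) s<))) eq ⟩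
        cellE u (c (a + (2 + s)) , p (a + (2 + s))) (c (suc (a + (2 + s))) , p (suc (a + (2 + s))))
          ≡⟨ adjacent _ _ (bound s<) (next s<) ⟩
        near (a + (2 + s)) (suc (a + (2 + s))) ≡⟨ near-true {a + (2 + s)} (inj₁ refl) ⟩
        true ∎) λ ())
    where
    open ≡-Reasoning
    bound : ∀ {s} → s ≤ n → a + s ≤ m
    bound s≤n = ≤-trans (+-monoʳ-≤ a s≤n) (<⇒≤ a+n<m)
    next : ∀ {s} → s ≤ n → a + s < m
    next s≤n = ≤-trans (s≤s (+-monoʳ-≤ a s≤n)) a+n<m
    same : ∀ s → s ≤ n → c (a + s) ≡ c a
    same zero    _  = cong c (+-identityʳ a)
    same (suc s) s< = trans (≡.sym (stay s s<)) (same s (<⇒≤ s<))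

  crossing : ∀ s t → s ≤ m → t ≤ m → c s ≢ c t → near s t ≡ u (p s) ∧ u (p t)
  crossing s t s≤ t≤ c≢ = trans (≡.sym (adjacent s t s≤ t≤)) (cellE-diff u (p s) (p t) c≢)

∧-true : ∀ {x y} → true ≡ x ∧ y → x ≡ true × y ≡ true
∧-true {true} {true} _ = refl , refl

-- If the edge from s to s + 1 leaves its component, then both ends carry the letter 1.
-- A vertex t ≥ s + 3 is outside the component of one of them and adjacent to neither,
-- so it carries 0. From s + 3 on the path thus stays in one component and reads only 0.
path-straight : ∀ {u c p} → Dense u → ∀ m → PathIn u (7 + m) c p →
  (∀ s → s ≤ m → c s ≡ c 0) × Straight p m
-- After a crossing at `s`, the vertices `s + 3` to `s + 6` read four zeros in a row, against
-- `dense`; the vertex `s + 7` keeps them from turning back. Hence the 7.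
path-straight {u} {c} {p} dense m P = stays⇒straight P 0 m (s≤s (m≤n+m m 6)) λ s s<m → stay s (<⇒≤ s<m)
  where
  module Cross (s : ℕ) (s≤m : s ≤ m) (c≢ : c s ≢ c (suc s)) where
    s≤ : s ≤ 7 + m
    s≤ = m≤n⇒m≤o+n 7 s≤m
    s+1≤ : suc s ≤ 7 + m
    s+1≤ = s≤s (m≤n⇒m≤o+n 6 s≤m)
    ones : u (p s) ≡ true × u (p (suc s)) ≡ true
    ones = ∧-true (trans (≡.sym (near-true {s} {suc s} (inj₁ refl))) (crossing P s (suc s) s≤ s+1≤ c≢))
    zeros : ∀ t → 3 + s ≤ t → t ≤ 7 + m → u (p t) ≡ false
    zeros t s<t t≤ with c s ≟ c t
    ... | no c≢t = trans (cong (_∧ u (p t)) (≡.sym (proj₁ ones)))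
      (trans (≡.sym (crossing P s t s≤ t≤ c≢t)) (near-false-far (<⇒≤ s<t)))
    ... | yes c≡t = trans (cong (_∧ u (p t)) (≡.sym (proj₂ ones)))
      (trans (≡.sym (crossing P (suc s) t s+1≤ t≤ λ e → c≢ (trans c≡t (≡.sym e)))) (near-false-far s<t))
    inside : ∀ {r} → r ≤ 3 → 3 + s + r < 7 + m
    inside {r} r≤3 = s≤s (subst (3 + s + r ≤_) (+-comm (3 + m) 3) (+-mono-≤ (+-monoʳ-≤ 3 s≤m) r≤3))
    bound : ∀ {r} → r ≤ 3 → 3 + s + r ≤ 7 + m
    bound = <⇒≤ ∘ inside
    stay′ : ∀ r → r < 3 → c (3 + s + r) ≡ c (3 + s + suc r)
    stay′ r r<3 with c (3 + s + r) ≟ c (3 + s + suc r)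
    ... | yes e = e
    ... | no e with () ← trans (cong (_∧ u (p (3 + s + suc r))) 
                (≡.sym (zeros (3 + s + r) (m≤m+n (3 + s) r) (bound (<⇒≤ r<3)))))
              (trans (≡.sym (crossing P (3 + s + r) (3 + s + suc r) (bound (<⇒≤ r<3)) (bound r<3) e))
                     (near-true (inj₁ (+-suc (3 + s) r))))
    impossible : ∀ {A : Set} → A
    impossible with straight-image _ 3 (proj₂ (stays⇒straight P (3 + s) 3 (inside ≤-refl) stay′))
    ... | y , image with dense y
    ... | o , o≤3 , one with image o o≤3
    ... | r , r≤3 , eq with () ← trans (≡.sym one) (trans (cong u (≡.sym eq))
              (zeros (3 + s + r) (m≤m+n (3 + s) r) (bound r≤3)))
  stay : ∀ s → s ≤ m → c s ≡ c (suc s)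
  stay s s≤m with c s ≟ c (suc s)
  ... | yes e = e
  ... | no e  = Cross.impossible s s≤m e

-- Extends a path indexed by `Fin (suc m)` to a sequence on `ℕ`. Beyond `m` it repeats the last
-- vertex, where `PathIn` asks nothing.
clamp : ∀ m → ℕ → Fin (suc m)
clamp m s = fromℕ< {s ⊓ m} (s≤s (m⊓n≤n s m))

toℕ-clamp : ∀ {m s} → s ≤ m → toℕ (clamp m s) ≡ s
toℕ-clamp {m} {s} s≤m = trans (toℕ-fromℕ< (s≤s (m⊓n≤n s m))) (m≤n⇒m⊓n≡m s≤m)

pathGraph : ∀ m → Path m
pathGraph m = record
  { graph = record
      { adj          = λ i j → near (toℕ i) (toℕ j)
      ; adj-sym      = λ i j → near-sym (toℕ i) (toℕ j)
      ; adj-loopless = λ i → near-irrefl (toℕ i)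
      }
  ; adj-spec = λ i j → near-true⁻¹ , near-true
  }

path-adj : ∀ {m} (P : Path m) i j → FinGraph.adj (Path.graph P) i j ≡ near (toℕ i) (toℕ j)
path-adj P i j = ⇔→≡ {z = true}
  (mk⇔ (near-true ∘ proj₁ (Path.adj-spec P i j)) (proj₂ (Path.adj-spec P i j) ∘ near-true⁻¹))

path-in : ∀ {u m} (P : Path m) (f : Fin (suc m) → ℕ × ℕ) →
  (∀ i j → cellE u (f i) (f j) ≡ FinGraph.adj (Path.graph P) i j) →
  PathIn u m (proj₁ ∘ f ∘ clamp m) (proj₂ ∘ f ∘ clamp m)
path-in {u} {m} P f f-adj = pathIn λ s t s≤ t≤ → trans (f-adj (clamp m s) (clamp m t))
  (trans (path-adj P (clamp m s) (clamp m t)) (cong₂ near (toℕ-clamp s≤) (toℕ-clamp t≤)))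

path-in-≤ : ∀ {u c p m n} → m ≤ n → PathIn u n c p → PathIn u m c p
path-in-≤ m≤n (pathIn adj) = pathIn λ s t s≤m t≤m → adj s t (≤-trans s≤m m≤n) (≤-trans t≤m m≤n)

-- Path-minimality, primality and incomparability

-- Shorter components would create modules: a single 0 is isolated, the ends of 0 1 0 are twins.
Inside : ℕ × ℕ → Set
Inside (k , i) = i ≤ 3 + k

triangle : (ℕ → Bool) → Graph
triangle u = Induced (grid u) Inside

vertex-≡ : ∀ {k i l j} {p : Inside (k , i)} {q : Inside (l , j)} → k ≡ l → i ≡ j →
           _≡_ {A = Σ (ℕ × ℕ) Inside} ((k , i) , p) ((l , j) , q)
vertex-≡ {p = p} {q} refl refl = cong (_ ,_) (≤-irrelevant p q)

↪-trans : ∀ {G H K} → G ↪ H → H ↪ K → G ↪ K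
↪-trans e f = record
  { map  = map f ∘ map e
  ; inj  = λ u v → inj e u v ∘ inj f (map e u) (map e v)
  ; pres = λ u v → trans (pres f (map e u) (map e v)) (pres e u v)
  }

triangle↪grid : ∀ u → triangle u ↪ grid u
triangle↪grid u = record
  { map  = proj₁
  ; inj  = λ _ _ e → vertex-≡ (cong proj₁ e) (cong proj₂ e)
  ; pres = λ _ _ → refl
  }

triangle-paths : ∀ u → HasLongPaths (triangle u)
triangle-paths u n = n , ≤-refl , pathGraph n , record
  { map  = λ i → (n , toℕ i) , ≤-trans (≤-pred (toℕ<n i)) (m≤n+m n 3)
  ; inj  = λ i j e → toℕ-injective (cong (proj₂ ∘ proj₁) e)
  ; pres = λ i j → cellE-same u n {toℕ i} {toℕ j}
  }

module Minimal {u : ℕ → Bool} (dense : Dense u) (recurrent : Recurrent u)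
               (S : V (triangle u) → Set) (paths : HasLongPaths (Induced (triangle u) S)) where

  InS : ℕ × ℕ → Set
  InS x = Σ (Inside x) λ p → S (x , p)

  interval : ∀ n → ∃₂ λ k y → ∀ i → i ≤ n → InS (k , y + i)
  interval n with paths (7 + n)
  ... | m , n≤m , P , e = K , proj₁ image , λ i i≤n → found i (proj₂ image i i≤n)
    where
    f : Fin (suc m) → ℕ × ℕ
    f = proj₁ ∘ proj₁ ∘ map e
    c p : ℕ → ℕ
    c = proj₁ ∘ f ∘ clamp m
    p = proj₂ ∘ f ∘ clamp m
    within : (∀ s → s ≤ n → c s ≡ c 0) × Straight p n
    within = path-straight {u} {c} {p} dense n (path-in-≤ n≤m (path-in {u} P f (pres e)))
    K : ℕ
    K = c 0
    image : ∃ λ y → ∀ i → i ≤ n → ∃ λ s → s ≤ n × p s ≡ y + i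
    image = straight-image p n (proj₂ within)
    in-S : (w : V (Induced (triangle u) S)) → ∀ {x} → proj₁ (proj₁ w) ≡ x → InS x
    in-S ((x , x-inside) , x∈S) refl = x-inside , x∈S
    found : ∀ i → ∃ (λ s → s ≤ n × p s ≡ proj₁ image + i) → InS (K , proj₁ image + i)
    found i (s , s≤n , eq) = in-S (map e (clamp m s)) (cong₂ _,_ (proj₁ within s s≤n) eq)

  -- A place in `S` for component `k`. Through `bound` successive copies go to ever later
  -- components, so that different components stay apart.
  record Copy (k bound : ℕ) : Set where
    field
      component start : ℕ
      bounded : bound ≤ component
      inS     : ∀ i → i ≤ 3 + k → InS (component , start + i)
      word    : ∀ i → i ≤ 3 + k → u (start + i) ≡ u i
  open Copy

  copy : ∀ k bound → Copy k bound
  copy k B = build (interval (N + (3 + B)))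
    where
    N = proj₁ (recurrent (3 + k))
    build : (∃₂ λ K y → ∀ i → i ≤ N + (3 + B) → InS (K , y + i)) → Copy k B
    build (K , y , y∈S) = locate (proj₂ (recurrent (3 + k)) y)
      where
      locate : (∃ λ o → o + (3 + k) ≤ N × (∀ i → i ≤ 3 + k → u (y + (o + i)) ≡ u i)) → Copy k B
      locate (o , o≤N , read) = record
        { component = K
        ; start     = y + o
        -- Component `K` ends at position `3 + K` and contains `y + (3 + B)`, whence `B ≤ K`.
        ; bounded   = +-cancelˡ-≤ 3 B K (≤-trans (m≤n+m (3 + B) y) (proj₁ (y∈S (3 + B) (m≤n+m (3 + B) N))))
        ; inS       = λ i i≤ → subst (λ x → InS (K , x)) (≡.sym (+-assoc y o i))
            (y∈S (o + i) (m≤n⇒m≤n+o (3 + B) (≤-trans (+-monoʳ-≤ o i≤) o≤N)))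
        ; word      = λ i i≤ → trans (cong u (+-assoc y o i)) (read i i≤)
        }

  copies : ∀ k → ∃ (Copy k)
  copies zero    = 0 , copy 0 0
  copies (suc k) = _ , copy (suc k) (suc (component (proj₂ (copies k))))

  target : ℕ → ℕ
  target k = component (proj₂ (copies k))

  target-mono : ∀ {k l} → k < l → target k < target l
  target-mono {k} {suc l} (s≤s k≤l) with m≤n⇒m<n∨m≡n k≤l
  ... | inj₁ k<l  = <-trans (target-mono k<l) (bounded (proj₂ (copies (suc l))))
  ... | inj₂ refl = bounded (proj₂ (copies (suc l)))

  target-injective : ∀ {k l} → target k ≡ target l → k ≡ l
  target-injective {k} {l} e with <-cmp k l
  ... | tri< k<l _ _ = contradiction e (<⇒≢ (target-mono k<l))
  ... | tri≈ _ k≡l _ = k≡l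
  ... | tri> _ _ l<k = contradiction (≡.sym e) (<⇒≢ (target-mono l<k))

  offset : ℕ → ℕ
  offset k = start (proj₂ (copies k))

  embed : triangle u ↪ Induced (triangle u) S
  embed = record
    { map = λ { ((k , i) , p) → (_ , proj₁ (inS (proj₂ (copies k)) i p)) , proj₂ (inS (proj₂ (copies k)) i p) }
    ; inj = λ { ((k , i) , _) ((l , j) , _) e → injective k i l j (cong (proj₁ ∘ proj₁) e) }
    ; pres = λ { ((k , i) , p) ((l , j) , q) → preserves k i l j p q (k ≟ l) }
    }
    where
    injective : ∀ k i l j {p : Inside (k , i)} {q : Inside (l , j)} →
      _≡_ {A = ℕ × ℕ} (target k , offset k + i) (target l , offset l + j) →
      _≡_ {A = V (triangle u)} ((k , i) , p) ((l , j) , q)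
    injective k i l j e with target-injective {k} {l} (cong proj₁ e)
    ... | refl = vertex-≡ refl (+-cancelˡ-≡ (offset k) i j (cong proj₂ e))
    preserves : ∀ k i l j → Inside (k , i) → Inside (l , j) → Dec (k ≡ l) →
      cellE u (target k , offset k + i) (target l , offset l + j) ≡ cellE u (k , i) (l , j)
    preserves k i .k j p q (yes refl) = trans (cellE-same u (target k) {offset k + i} {offset k + j})
      (trans (near-shift (offset k) i j) (≡.sym (cellE-same u k {i} {j})))
    preserves k i l j p q (no k≢l) = trans (cellE-diff u (offset k + i) (offset l + j) (k≢l ∘ target-injective))
      (trans (cong₂ _∧_ (word (proj₂ (copies k)) i p) (word (proj₂ (copies l)) j q)) (≡.sym (cellE-diff u i j k≢l)))

triangle-minimal : ∀ {u} → Dense u → Recurrent u → PathMinimal (triangle u)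
triangle-minimal {u} dense recurrent = triangle-paths u , λ S paths → Minimal.embed dense recurrent S paths

-- Nontrivial modules spread over all components

module Primality {u : ℕ → Bool} (u0 : u 0 ≡ false) (u1 : u 1 ≡ true)
                 (isolated : ∀ i → u (suc i) ≡ true → u i ≡ false)
                 (A : V (triangle u) → Set) (module-A : IsModule (triangle u) A) where

  -- Since `A` is an arbitrary predicate, a separating vertex is only shown not to lie outside it;
  -- the goal being a negation, this suffices.
  In : ℕ → ℕ → Set
  In k i = Σ (Inside (k , i)) λ p → ¬ ¬ A ((k , i) , p)

  separates : ∀ {m t k i l j} → Inside (m , t) → In k i → In l j →
    cellE u (m , t) (k , i) ≡ true → cellE u (m , t) (l , j) ≡ false → In m t
  separates p (q , a) (r , b) e f = p , λ ∉A → a λ a∈A → b λ b∈A →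
    module-A _ ∉A _ _ a∈A b∈A (e , f)

  separates-row : ∀ {k t i j} → Inside (k , t) → In k i → In k j →
    near t i ≡ true → near t j ≡ false → In k t
  separates-row {k} {t} {i} {j} p a b e f =
    separates p a b (trans (cellE-same u k {t} {i}) e) (trans (cellE-same u k {t} {j}) f)

  below : ∀ {k i} → Inside (k , suc i) → Inside (k , i)
  below = <⇒≤

  near-suc : ∀ i → near i (suc i) ≡ true
  near-suc i = near-true {i} (inj₁ refl)

  near-pred : ∀ i → near (suc i) i ≡ true
  near-pred i = near-true {suc i} {i} (inj₂ refl)

  down : ∀ {k} i → In k i → In k (suc i) → In k 0 × In k 1
  down zero    a b = a , b
  down (suc i) a b = down i (separates-row (below (proj₁ a)) a b (near-suc i) (near-false-far {i} ≤-refl)) a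

  far-sym : ∀ {i j} → suc i < j → near j i ≡ false
  far-sym {i} {j} p = trans (near-sym j i) (near-false-far p)

  up : ∀ {k} → In k 0 → In k 1 → ∀ i → Inside (k , suc i) → In k i × In k (suc i)
  up a b zero    p = a , b
  up a b (suc i) p with up a b i (<⇒≤ p)
  ... | c , d = d , separates-row p d c (near-pred (suc i)) (far-sym {i} ≤-refl)

  -- The position next to two consecutive ones sees exactly one of them, so the module spreads down
  -- to 0 and from there up the whole row.
  full : ∀ {k} i → In k i → In k (suc i) → ∀ j → Inside (k , j) → In k j
  full i a b j p with down i a b
  full i a b zero    p | c , d = c
  full i a b (suc j) p | c , d = proj₂ (up c d j p)

  Pair : ℕ → Set
  Pair k = ∃ λ i → In k i × In k (suc i)

  -- At distance above 2, `i + 1` sees only `i`. At distance 2 it sees both, but the outer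
  -- neighbours `i + 3` and `i - 1` see one, and a row of at least four positions has one of them.
  pair-in-row : ∀ {k i j} → i < j → In k i → In k j → Pair k
  pair-in-row {k} {i} {j} i<j a b with m≤n⇒m<n∨m≡n i<j
  ... | inj₂ refl = i , a , b
  ... | inj₁ 1+i<j with m≤n⇒m<n∨m≡n 1+i<j
  ...   | inj₁ 2+i<j = i , a , separates-row (≤-trans i<j (proj₁ b)) a b (near-pred i) (near-false-far {suc i} 2+i<j)
  ...   | inj₂ refl with 3 + i ≤? 3 + k
  ...     | yes p = 2 + i , b , separates-row p b a (near-pred (2 + i)) (far-sym {i} (n≤1+n (2 + i)))
  pair-in-row {k} {zero}  _ a b | inj₁ _ | inj₂ refl | no ¬p = contradiction (m≤m+n 3 k) ¬p
  pair-in-row {k} {suc i} _ a b | inj₁ _ | inj₂ refl | no ¬p =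
    i , separates-row (below (proj₁ a)) a b (near-suc i) (near-false-far {i} (n≤1+n (2 + i))) , a

  -- A full row shows a 0 and a 1, which position 1 of row `l` tells apart. Position 0 of row `l`
  -- then sees position 1 and, carrying 0, nothing in row `k`.
  pair-elsewhere : ∀ {k l} → k ≢ l → Pair k → Pair l
  pair-elsewhere {k} {l} k≢l (i , a , b) = 0 , zeroth , first
    where
    first : In l 1
    first = separates (m≤n⇒m≤n+o l (s≤s z≤n)) (full i a b 1 (m≤n⇒m≤n+o k (s≤s z≤n))) (full i a b 0 z≤n)
      (trans (cellE-diff u 1 1 (k≢l ∘ ≡.sym)) (cong₂ _∧_ u1 u1))
      (trans (cellE-diff u 1 0 (k≢l ∘ ≡.sym)) (cong₂ _∧_ u1 u0))
    zeroth : In l 0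
    zeroth = separates z≤n first (full i a b 0 z≤n)
      (trans (cellE-same u l {0} {1}) refl) (trans (cellE-diff u 0 0 (k≢l ∘ ≡.sym)) (cong₂ _∧_ u0 u0))

  -- If `(k , i)` carries 1, its predecessor carries 0 and so sees it but not `(l , j)`. If it
  -- carries 0, no row neighbour of `(l , j)` sees it.
  pair-across : ∀ {k i l j} → k ≢ l → In k i → In l j → Pair k ⊎ Pair l
  pair-across {k} {i} {l} {j} k≢l a b with u i in ui
  pair-across {k} {zero} {l} {j} k≢l a b | true with () ← trans (≡.sym ui) u0
  pair-across {k} {suc i} {l} {j} k≢l a b | true = inj₁ (i ,
    separates (below (proj₁ a)) a b (trans (cellE-same u k {i} {suc i}) (near-suc i))
      (trans (cellE-diff u i j k≢l) (cong (_∧ u j) (isolated i ui))) , a)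
  pair-across {k} {i} {l} {zero} k≢l a b | false = inj₂ (0 , b ,
    separates (m≤n⇒m≤n+o l (s≤s z≤n)) b a (trans (cellE-same u l {1} {0}) refl)
      (trans (cellE-diff u 1 i (k≢l ∘ ≡.sym)) (cong₂ _∧_ u1 ui)))
  pair-across {k} {i} {l} {suc j} k≢l a b | false = inj₂ (j ,
    separates (below (proj₁ b)) b a (trans (cellE-same u l {j} {suc j}) (near-suc j))
      (trans (cellE-diff u j i (k≢l ∘ ≡.sym)) (trans (cong (u j ∧_) ui) (∧-zeroʳ (u j)))) , b)

  some-pair : ∀ {k i l j} (p : Inside (k , i)) (q : Inside (l , j)) →
    A ((k , i) , p) → A ((l , j) , q) → ((k , i) , p) ≢ ((l , j) , q) → ∃ Pair
  some-pair {k} {i} {l} {j} p q a b a≢b with k ≟ l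
  ... | no k≢l = [ (k ,_) , (l ,_) ]′ (pair-across k≢l (p , λ ∉A → ∉A a) (q , λ ∉A → ∉A b))
  ... | yes refl with <-cmp i j
  ...   | tri< i<j _ _ = k , pair-in-row i<j (p , λ ∉A → ∉A a) (q , λ ∉A → ∉A b)
  ...   | tri≈ _ i≡j _ = contradiction (vertex-≡ refl i≡j) a≢b
  ...   | tri> _ _ j<i = k , pair-in-row j<i (q , λ ∉A → ∉A b) (p , λ ∉A → ∉A a)

  excludes : ∀ {l j} (r : Inside (l , j)) → ¬ A ((l , j) , r) → ¬ In l j
  excludes {l} {j} r c∉A (s , c) = subst (λ r → ¬ ¬ A ((l , j) , r)) (≤-irrelevant s r) c c∉A

  trivial : ¬ NonTrivial (triangle u) A
  trivial ((((_ , p)) , (_ , q) , a , b , a≢b) , ((l , j) , r) , c∉A) with some-pair p q a b a≢b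
  ... | k , i , a′ , b′ with k ≟ l
  ...   | yes refl = excludes r c∉A (full i a′ b′ j r)
  ...   | no k≢l with pair-elsewhere k≢l (i , a′ , b′)
  ...     | i′ , a″ , b″ = excludes r c∉A (full i′ a″ b″ j r)

triangle-prime : ∀ {u} → u 0 ≡ false → u 1 ≡ true → (∀ i → u (suc i) ≡ true → u i ≡ false) →
                 Prime (triangle u)
triangle-prime u0 u1 isolated =
  ((λ i → (0 , toℕ i) , ≤-pred (toℕ<n i)) , λ i j e → toℕ-injective (cong (proj₂ ∘ proj₁) e)) ,
  Primality.trivial u0 u1 isolated

-- Reading a word through a probe vertex

near-far : ∀ q x → near q x ≡ true → near q (4 + x) ≡ true → ⊥
near-far q x e f with near-true⁻¹ {q} {x} e | near-true⁻¹ {q} {4 + x} f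
... | inj₁ refl | inj₁ ()
... | inj₁ refl | inj₂ g = m≢1+n+m q {5} g
... | inj₂ refl | inj₁ g = m≢1+n+m x {1} (≡.sym (suc-injective (suc-injective g)))
... | inj₂ refl | inj₂ g = m≢1+n+m (suc x) {3} g

module Incomparable {u v : ℕ → Bool} (dense : Dense v) (u1 : u 1 ≡ true) (u5 : u 5 ≡ true)
                    (age⊆ : AgeSubset (triangle u) (triangle v)) (n : ℕ) where
  -- `path-straight` costs 7 vertices, and 5 more keep vertex 5 in the straight part, as `elsewhere`
  -- requires.
  m = 12 + n

  f : Fin (2 + m) → V (triangle u)
  f fzero    = (suc m , 1) , s≤s z≤n
  f (fsuc i) = (m , toℕ i) , ≤-trans (≤-pred (toℕ<n i)) (m≤n+m m 3)

  -- A path reading a prefix of u, and one further vertex that is adjacent to the 1s of it.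
  probe : FinGraph (2 + m)
  probe = record
    { adj          = λ i j → E (triangle u) (f i) (f j)
    ; adj-sym      = λ i j → Graph.sym (triangle u) (f i) (f j)
    ; adj-loopless = λ i → loopless (triangle u) (f i)
    }

  probe↪ : finToGraph probe ↪ triangle u
  probe↪ = record { map = f ; inj = injective ; pres = λ _ _ → refl }
    where
    injective : ∀ i j → f i ≡ f j → i ≡ j
    injective fzero    fzero    _ = refl
    injective fzero    (fsuc j) e = contradiction (cong (proj₁ ∘ proj₁) e) 1+n≢n
    injective (fsuc i) fzero    e = contradiction (≡.sym (cong (proj₁ ∘ proj₁) e)) 1+n≢n
    injective (fsuc i) (fsuc j) e = cong fsuc (toℕ-injective (cong (proj₂ ∘ proj₁) e))

  e = age⊆ (2 + m) probe probe↪

  g : Fin (suc m) → ℕ × ℕ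
  g = proj₁ ∘ map e ∘ fsuc

  c p : ℕ → ℕ
  c = proj₁ ∘ g ∘ clamp m
  p = proj₂ ∘ g ∘ clamp m

  within : (∀ s → s ≤ 5 + n → c s ≡ c 0) × Straight p (5 + n)
  within = path-straight {v} {c} {p} dense (5 + n) (path-in {v} (pathGraph m) g λ i j →
    trans (pres e (fsuc i) (fsuc j)) (cellE-same u m {toℕ i} {toℕ j}))

  l q : ℕ
  l = proj₁ (proj₁ (map e fzero))
  q = proj₂ (proj₁ (map e fzero))

  probed : ∀ s → s ≤ 5 + n → cellE v (l , q) (c 0 , p s) ≡ u s
  probed s s≤ = begin
    cellE v (l , q) (c 0 , p s)            ≡⟨ cong (λ k → cellE v (l , q) (k , p s)) (proj₁ within s s≤) ⟨
    cellE v (l , q) (c s , p s)            ≡⟨ pres e fzero (fsuc (clamp m s)) ⟩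
    cellE u (suc m , 1) (m , toℕ (clamp m s)) ≡⟨ cellE-diff u {suc m} {m} 1 (toℕ (clamp m s)) 1+n≢n ⟩
    u 1 ∧ u (toℕ (clamp m s))              ≡⟨ cong₂ _∧_ u1 (cong u (toℕ-clamp (m≤n⇒m≤o+n 7 s≤))) ⟩
    u s                                    ∎
    where open ≡-Reasoning

  -- Within its own component a vertex sees no two positions 4 apart, but the probe sees the
  -- vertices 1 and 5 of a straight path.
  elsewhere : l ≢ c 0
  elsewhere l≡c0 = not-both (proj₂ within)
    where
    touches : ∀ s → s ≤ 5 + n → u s ≡ true → near q (p s) ≡ true
    touches s s≤ us = trans (≡.sym (cellE-same v l {q} {p s}))
      (trans (cong (λ k → cellE v (l , q) (k , p s)) l≡c0) (trans (probed s s≤) us))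
    at1 = touches 1 (s≤s z≤n) u1
    at5 = touches 5 (m≤m+n 5 n) u5
    not-both : Straight p (5 + n) → ⊥
    not-both (inj₁ up) = near-far q (p 1) at1 (subst (λ x → near q x ≡ true) (begin
      p 5     ≡⟨ up 5 (m≤m+n 5 n) ⟩
      p 0 + 5 ≡⟨ lemma (p 0) ⟩
      4 + (p 0 + 1) ≡⟨ cong (4 +_) (up 1 (s≤s z≤n)) ⟨
      4 + p 1 ∎) at5)
      where
      open ≡-Reasoning
      lemma : ∀ x → x + 5 ≡ 4 + (x + 1)
      lemma = solve-∀
    not-both (inj₂ down) = near-far q (p 5) at5 (subst (λ x → near q x ≡ true) (+-cancelʳ-≡ 1 (p 1) (4 + p 5) (begin
      p 1 + 1 ≡⟨ down 1 (s≤s z≤n) ⟩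
      p 0     ≡⟨ down 5 (m≤m+n 5 n) ⟨
      p 5 + 5 ≡⟨ lemma (p 5) ⟩
      4 + p 5 + 1 ∎)) at1)
      where
      open ≡-Reasoning
      lemma : ∀ x → x + 5 ≡ 4 + x + 1
      lemma = solve-∀

  -- The probe sees the 1 at `s = 1`, so its own letter is 1 and masks nothing.
  same-letter : ∀ s → s ≤ 5 + n → u s ≡ v (p s)
  same-letter s s≤ = trans (read s s≤) (cong (_∧ v (p s)) vq)
    where
    read : ∀ s → s ≤ 5 + n → u s ≡ v q ∧ v (p s)
    read s s≤ = trans (≡.sym (probed s s≤)) (cellE-diff v q (p s) elsewhere)
    vq : v q ≡ true
    vq = proj₁ (∧-true (trans (≡.sym u1) (read 1 (s≤s z≤n))))

dense : ∀ a → Dense (toeplitz (levels a))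
dense a y with toeplitz-hits 1 (levels a) y
... | o , s≤s o≤3 , one = o , o≤3 , one

isolated : ∀ a i → toeplitz (levels a) (suc i) ≡ true → toeplitz (levels a) i ≡ false
isolated a i p with parity i
... | even q = toeplitz-even (levels a) q
... | odd q with () ← trans (≡.sym p) (trans (cong (toeplitz (levels a)) (cong suc (≡.sym (+-suc q q))))
                              (toeplitz-even (levels a) (suc q)))

-- The image path may run downwards and read the prefix backwards; `reverse-occurrence` then turns
-- it round.
age-occurs : ∀ a b → AgeSubset (triangle (toeplitz (levels a))) (triangle (toeplitz (levels b))) →
             Occurs (toeplitz (levels a)) (toeplitz (levels b))
age-occurs a b age⊆ n = occurrence (proj₂ within)
  where
  open Incomparable {toeplitz (levels a)} {toeplitz (levels b)} (dense b) refl refl age⊆ n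
  occurrence : Straight p (5 + n) → ∃ λ y → ∀ i → i ≤ n → toeplitz (levels a) i ≡ toeplitz (levels b) (y + i)
  occurrence (inj₁ up) = p 0 , λ i i≤n → trans (same-letter i (m≤n⇒m≤o+n 5 i≤n))
    (cong (toeplitz (levels b)) (up i (m≤n⇒m≤o+n 5 i≤n)))
  occurrence (inj₂ down) with reverse-occurrence (levels b) (p n) n
  ... | y , eq = y , λ i i≤n → trans (same-letter i (m≤n⇒m≤o+n 5 i≤n))
    (eq i (p i) i≤n (trans (down i (m≤n⇒m≤o+n 5 i≤n)) (≡.sym (down n (m≤n+m n 5)))))

age-≗ : ∀ a b → AgeSubset (triangle (toeplitz (levels a))) (triangle (toeplitz (levels b))) →
        ∀ k → a k ≡ b k
age-≗ a b age⊆ k = begin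
  a k                    ≡⟨ levels-2+3k a k ⟨
  levels a (2 + k * 3)   ≡⟨ occurs⇒≗ (2 + k * 3) (levels a) (levels b) (levels-unsteady b) (age-occurs a b age⊆) ⟩
  levels b (2 + k * 3)   ≡⟨ levels-2+3k b k ⟩
  b k                    ∎
  where open ≡-Reasoning

-- Well-quasi-ordering

-- (y , n) stands for the positions y, …, y + n.
Segment : Set
Segment = ℕ × ℕ

module _ (u : ℕ → Bool) where

  OccursAt : ℕ → Segment → ℕ → Set
  OccursAt o (y , n) z = ∀ {i} → i < suc n → u (y + i) ≡ u (z + (o + i))

  Factor : Segment → Segment → Set
  Factor (y , n) (z , m) = ∃ λ o → o < suc m × (o + n ≤ m × OccursAt o (y , n) z)

  factor? : Decidable Factor
  factor? (y , n) (z , m) = anyUpTo?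
    (λ o → (o + n ≤? m) ×-dec allUpTo? (λ i → u (y + i) Bool.≟ u (z + (o + i))) (suc n)) (suc m)

  Agree : ℕ → ℕ → ℕ → Set
  Agree N y z = ∀ {i} → i < N → u (y + i) ≡ u (z + i)

  agree? : ∀ N → Decidable (Agree N)
  agree? N y z = allUpTo? (λ i → u (y + i) Bool.≟ u (z + i)) N

  af-agree : ∀ N → AlmostFull (Agree N)
  af-agree zero    = now λ _ _ ()
  af-agree (suc N) = af-map (λ y → y , u (y + N)) extend
    (af-× (agree? N) Bool._≟_ (af-agree N) af-Bool)
    where
    extend : ∀ y z → Agree N y z × u (y + N) ≡ u (z + N) → Agree (suc N) y z
    extend y z (agree , eq) (s≤s i≤N) with m≤n⇒m<n∨m≡n i≤N
    ... | inj₁ i<N  = agree i<N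
    ... | inj₂ refl = eq

  -- By recurrence all sufficiently long segments are above a given one, and those of
  -- bounded length read finitely many words.
  af-factor : Recurrent u → AlmostFull Factor
  af-factor recurrent = later λ (y , n) → above y n (recurrent (y + n))
    where
    above : ∀ y n → (∃ λ N → ∀ z → ∃ λ o → o + (y + n) ≤ N × (∀ i → i ≤ y + n → u (z + (o + i)) ≡ u i)) →
            AlmostFull (Factor ↑ (y , n))
    above y n (N , occurs) = af-map id compare (af-× (agree? N) _≤?_ (af-agree N) af-≤)
      where
      compare : ∀ (s t : Segment) → Agree N (proj₁ s) (proj₁ t) × proj₂ s ≤ proj₂ t → (Factor ↑ (y , n)) s t
      compare (z , m) (z′ , m′) (agree , m≤m′) with N ≤? m
      -- The earlier segment has at most `N` letters, all of which the later one repeats at its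
      -- start.
      ... | no N≰m = inj₁ (0 , s≤s z≤n , m≤m′ , λ { (s≤s i≤m) → agree (≤-<-trans i≤m (≰⇒> N≰m)) })
      ... | yes N≤m with occurs z
      -- The prefix found at `o` contains the positions `y` to `y + n`, hence the drawn segment at
      -- `o + y`.
      ...   | o , o≤N , read = inj₂ (o + y , s≤s (≤-trans (m≤m+n (o + y) n) fits) , fits , λ { {i} (s≤s i≤n) →
              trans (≡.sym (read (y + i) (+-monoʳ-≤ y i≤n))) (cong (λ x → u (z + x)) (≡.sym (+-assoc o y i))) })
        where
        fits : o + y + n ≤ m
        fits = ≤-trans (≤-reflexive (+-assoc o y n)) (≤-trans o≤N N≤m)

-- Finite vertex sets as lists of lists of segments

_∈ˢ_ : ℕ → Segment → Set
i ∈ˢ (y , n) = ∃ λ d → d ≤ n × i ≡ y + d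

_∈ˡ_ : ℕ → List Segment → Set
i ∈ˡ L = Any (i ∈ˢ_) L

-- The `2 +` leaves a free position between consecutive segments, so no edge of the row joins them.
data Separated : ℕ → List Segment → Set where
  []  : ∀ {b} → Separated b []
  _∷_ : ∀ {b y n L} → b ≤ y → Separated (2 + (y + n)) L → Separated b ((y , n) ∷ L)

separated-≤ : ∀ {b L i} → Separated b L → i ∈ˡ L → b ≤ i
separated-≤ (b≤y ∷ _)   (here (d , _ , refl)) = m≤n⇒m≤n+o d b≤y
separated-≤ (_∷_ {y = y} {n} b≤y sep) (there i∈)            =
  ≤-trans (m≤n⇒m≤n+o n b≤y) (≤-trans (m≤n+m (y + n) 2) (separated-≤ sep i∈))

separated-weaken : ∀ {a b L} → a ≤ b → Separated b L → Separated a L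
separated-weaken a≤b []          = []
separated-weaken a≤b (b≤y ∷ sep) = ≤-trans a≤b b≤y ∷ sep

push : ℕ → List Segment → List Segment
push b []            = (b , 0) ∷ []
push b ((y , n) ∷ L) with y ≟ suc b
... | yes _ = (b , suc n) ∷ L
... | no _  = (b , 0) ∷ (y , n) ∷ L

push-separated : ∀ {b L} → Separated (suc b) L → Separated b (push b L)
push-separated [] = ≤-refl ∷ []
push-separated {b} (_∷_ {y = y} {n} {L} b<y sep) with y ≟ suc b
... | yes refl = ≤-refl ∷ subst (λ x → Separated (2 + x) L) (≡.sym (+-suc b n)) sep
... | no y≢    = ≤-refl ∷ (subst (λ x → 2 + x ≤ y) (≡.sym (+-identityʳ b)) (≤∧≢⇒< b<y (y≢ ∘ ≡.sym)) ∷ sep)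

push-∈ : ∀ b L {i} → i ≡ b ⊎ i ∈ˡ L → i ∈ˡ push b L
push-∈ b [] (inj₁ refl) = here (0 , z≤n , ≡.sym (+-identityʳ b))
push-∈ b ((y , n) ∷ L) i∈ with y ≟ suc b | i∈
... | yes refl | inj₁ refl                   = here (0 , z≤n , ≡.sym (+-identityʳ b))
... | yes refl | inj₂ (here (d , d≤n , refl)) = here (suc d , s≤s d≤n , ≡.sym (+-suc b d))
... | yes refl | inj₂ (there q)              = there q
... | no _     | inj₁ refl                   = here (0 , z≤n , ≡.sym (+-identityʳ b))
... | no _     | inj₂ q                      = there q

push-∈⁻¹ : ∀ b L {i} → i ∈ˡ push b L → i ≡ b ⊎ i ∈ˡ L
push-∈⁻¹ b [] (here (zero , _ , refl)) = inj₁ (+-identityʳ b)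
push-∈⁻¹ b ((y , n) ∷ L) i∈ with y ≟ suc b | i∈
... | yes refl | here (zero  , _ , refl)       = inj₁ (+-identityʳ b)
... | yes refl | here (suc d , s≤s d≤n , refl) = inj₂ (here (d , d≤n , +-suc b d))
... | yes refl | there q                       = inj₂ (there q)
... | no _     | here (zero , _ , refl)        = inj₁ (+-identityʳ b)
... | no _     | there q                       = inj₂ q

-- The maximal segments of { i | s i ≡ true, b ≤ i < b + l }.
runs : (ℕ → Bool) → ℕ → ℕ → List Segment
runs s b zero    = []
runs s b (suc l) = if s b then push b (runs s (suc b) l) else runs s (suc b) l

runs-separated : ∀ s b l → Separated b (runs s b l)
runs-separated s b zero = []
runs-separated s b (suc l) with s b
... | true  = push-separated (runs-separated s (suc b) l)
... | false = separated-weaken (n≤1+n b) (runs-separated s (suc b) l)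

runs-complete : ∀ s b l {i} → b ≤ i → i < b + l → s i ≡ true → i ∈ˡ runs s b l
runs-complete s b zero b≤i i< si = contradiction (≤-<-trans b≤i (subst (_ <_) (+-identityʳ b) i<)) (<-irrefl refl)
runs-complete s b (suc l) {i} b≤i i< si with m≤n⇒m<n∨m≡n b≤i
... | inj₂ refl rewrite si = push-∈ b (runs s (suc b) l) (inj₁ refl)
... | inj₁ b<i with s b | runs-complete s (suc b) l b<i (subst (i <_) (+-suc b l) i<) si
...   | true  | q = push-∈ b (runs s (suc b) l) (inj₂ q)
...   | false | q = q

runs-sound : ∀ s b l {i} → i ∈ˡ runs s b l → s i ≡ true
runs-sound s b (suc l) i∈ with s b in sb
... | false = runs-sound s (suc b) l i∈
... | true with push-∈⁻¹ b (runs s (suc b) l) i∈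
...   | inj₁ refl = sb
...   | inj₂ q    = runs-sound s (suc b) l q

-- `near-≡` will give the edges inside the row, `letter-≡` those to other rows, and `mono`
-- injectivity.
record RowMap (u : ℕ → Bool) (g : ℕ → ℕ) (L L′ : List Segment) : Set where
  field
    member : ∀ {i} → i ∈ˡ L → g i ∈ˡ L′
    letter-≡ : ∀ {i} → i ∈ˡ L → u (g i) ≡ u i
    mono   : ∀ {i j} → i ∈ˡ L → j ∈ˡ L → i < j → g i < g j
    near-≡ : ∀ {i j} → i ∈ˡ L → j ∈ˡ L → i < j → near (g i) (g j) ≡ near i j

module MatchSegment (u : ℕ → Bool) {y n z m o L L′} (o+n≤m : o + n ≤ m) (occurs : OccursAt u o (y , n) z)
                    (sep : Separated (2 + (y + n)) L) (sep′ : Separated (2 + (z + m)) L′)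
                    (g : ℕ → ℕ) (row : RowMap u g L L′) where
  open RowMap row

  g⁺ : ℕ → ℕ
  g⁺ i = if does (i ≤? y + n) then z + (o + (i ∸ y)) else g i

  g⁺-head : ∀ {d} → d ≤ n → g⁺ (y + d) ≡ z + (o + d)
  g⁺-head {d} d≤n rewrite dec-true (y + d ≤? y + n) (+-monoʳ-≤ y d≤n) | m+n∸m≡n y d = refl

  beyond : ∀ {i} → i ∈ˡ L → 2 + (y + n) ≤ i
  beyond = separated-≤ sep

  g⁺-tail : ∀ {i} → i ∈ˡ L → g⁺ i ≡ g i
  g⁺-tail {i} i∈ rewrite dec-false (i ≤? y + n) (<⇒≱ (<⇒≤ (beyond i∈))) = refl

  gap : ∀ {d i} → d ≤ n → i ∈ˡ L → suc (y + d) < i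
  gap d≤n i∈ = ≤-trans (s≤s (s≤s (+-monoʳ-≤ y d≤n))) (beyond i∈)

  gap′ : ∀ {d i} → d ≤ n → i ∈ˡ L → suc (z + (o + d)) < g i
  gap′ d≤n i∈ = ≤-trans (s≤s (s≤s (+-monoʳ-≤ z (≤-trans (+-monoʳ-≤ o d≤n) o+n≤m)))) (separated-≤ sep′ (member i∈))

  extended : RowMap u g⁺ ((y , n) ∷ L) ((z , m) ∷ L′)
  extended = record { member = member⁺ ; letter-≡ = letter⁺ ; mono = mono⁺ ; near-≡ = near⁺ }
    where
    member⁺ : ∀ {i} → i ∈ˡ ((y , n) ∷ L) → g⁺ i ∈ˡ ((z , m) ∷ L′)
    member⁺ (here (d , d≤n , refl)) = here (o + d , ≤-trans (+-monoʳ-≤ o d≤n) o+n≤m , g⁺-head d≤n)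
    member⁺ (there i∈) = there (subst (_∈ˡ L′) (≡.sym (g⁺-tail i∈)) (member i∈))
    letter⁺ : ∀ {i} → i ∈ˡ ((y , n) ∷ L) → u (g⁺ i) ≡ u i
    letter⁺ (here (d , d≤n , refl)) = trans (cong u (g⁺-head d≤n)) (≡.sym (occurs (s≤s d≤n)))
    letter⁺ (there i∈) = trans (cong u (g⁺-tail i∈)) (letter-≡ i∈)
    mono⁺ : ∀ {i j} → i ∈ˡ ((y , n) ∷ L) → j ∈ˡ ((y , n) ∷ L) → i < j → g⁺ i < g⁺ j
    mono⁺ (here (d , d≤n , refl)) (here (e , e≤n , refl)) i<j rewrite g⁺-head d≤n | g⁺-head e≤n =
      +-monoʳ-< z (+-monoʳ-< o (+-cancelˡ-< y d e i<j))
    mono⁺ (here (d , d≤n , refl)) (there j∈) i<j rewrite g⁺-head d≤n | g⁺-tail j∈ = <⇒≤ (gap′ d≤n j∈)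
    mono⁺ (there i∈) (here (e , e≤n , refl)) i<j = contradiction i<j (<-asym (<⇒≤ (gap e≤n i∈)))
    mono⁺ (there i∈) (there j∈) i<j rewrite g⁺-tail i∈ | g⁺-tail j∈ = mono i∈ j∈ i<j
    near⁺ : ∀ {i j} → i ∈ˡ ((y , n) ∷ L) → j ∈ˡ ((y , n) ∷ L) → i < j → near (g⁺ i) (g⁺ j) ≡ near i j
    near⁺ (here (d , d≤n , refl)) (here (e , e≤n , refl)) i<j = begin
      near (g⁺ (y + d)) (g⁺ (y + e))       ≡⟨ cong₂ near (g⁺-head d≤n) (g⁺-head e≤n) ⟩
      near (z + (o + d)) (z + (o + e))     ≡⟨ near-shift z (o + d) (o + e) ⟩
      near (o + d) (o + e)                 ≡⟨ near-shift o d e ⟩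
      near d e                             ≡⟨ near-shift y d e ⟨
      near (y + d) (y + e)                 ∎
      where open ≡-Reasoning
    near⁺ {j = j} (here (d , d≤n , refl)) (there j∈) i<j =
      trans (cong₂ near (g⁺-head d≤n) (g⁺-tail j∈))
        (trans (near-false-far {z + (o + d)} (gap′ d≤n j∈)) (≡.sym (near-false-far {y + d} (gap d≤n j∈))))
    near⁺ (there i∈) (here (e , e≤n , refl)) i<j = contradiction i<j (<-asym (<⇒≤ (gap e≤n i∈)))
    near⁺ (there i∈) (there j∈) i<j = trans (cong₂ near (g⁺-tail i∈) (g⁺-tail j∈)) (near-≡ i∈ j∈ i<j)

-- Each matched segment is translated into its partner. Different segments have different partners,
-- which are separated as well, so no nearness arises between them.
row-map : ∀ u {b b′ L L′} → Separated b L → Separated b′ L′ → Sublist (Factor u) L L′ → ∃ λ g → RowMap u g L L′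
row-map u _ _ [] = id , record { member = λ () ; letter-≡ = λ () ; mono = λ () ; near-≡ = λ () }
row-map u sep (_ ∷ sep′) (_ ∷ʳ p) with row-map u sep sep′ p
... | g , row = g , record { member = there ∘ member ; letter-≡ = letter-≡ ; mono = mono ; near-≡ = near-≡ }
  where open RowMap row
row-map u (_ ∷ sep) (_ ∷ sep′) ((o , _ , o+n≤m , occurs) ∷ p) with row-map u sep sep′ p
... | g , row = MatchSegment.g⁺ u o+n≤m occurs sep sep′ g row , MatchSegment.extended u o+n≤m occurs sep sep′ g row

-- A finite set s of vertices of the grid is coded by the maximal segments of each of its
-- rows; N bounds the positions and l the number of rows.
rows : (ℕ → ℕ → Bool) → ℕ → ℕ → ℕ → List (List Segment)
rows s N b zero    = []
rows s N b (suc l) = runs (s b) 0 N ∷ rows s N (suc b) l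

-- Strictly increasing rows keep vertices of different rows in different rows, where adjacency
-- depends on letters alone. The bound `above` carries the induction.
record GridMap (u : ℕ → Bool) (s s′ : ℕ → ℕ → Bool) (N N′ : ℕ) (b l b′ : ℕ) : Set where
  field
    rowOf : ℕ → ℕ
    posOf : ℕ → ℕ → ℕ
    above : ∀ {k} → b ≤ k → k < b + l → b′ ≤ rowOf k
    row-mono : ∀ {k k′} → b ≤ k → k < k′ → k′ < b + l → rowOf k < rowOf k′
    row : ∀ {k} → b ≤ k → k < b + l → RowMap u (posOf k) (runs (s k) 0 N) (runs (s′ (rowOf k)) 0 N′)

grid-map : ∀ u s s′ N N′ b l b′ l′ → Sublist (Sublist (Factor u)) (rows s N b l) (rows s′ N′ b′ l′) →
           GridMap u s s′ N N′ b l b′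
grid-map u s s′ N N′ b zero b′ l′ _ = record
  { rowOf = id ; posOf = λ _ → id
  ; above = λ b≤k k<b → absurd b≤k k<b
  ; row-mono = λ b≤k k<k′ k′<b → absurd (<⇒≤ (≤-<-trans b≤k k<k′)) k′<b
  ; row = λ b≤k k<b → absurd b≤k k<b
  }
  where
  absurd : ∀ {A : Set} {k} → b ≤ k → k < b + 0 → A
  absurd b≤k k<b = contradiction (≤-<-trans b≤k (subst (_ <_) (+-identityʳ b) k<b)) (<-irrefl refl)
grid-map u s s′ N N′ b (suc l) b′ (suc l′) (_ ∷ʳ p) = record
  { rowOf = rowOf ; posOf = posOf
  ; above = λ b≤k k< → <⇒≤ (above b≤k k<)
  ; row-mono = row-mono ; row = row }
  where open GridMap (grid-map u s s′ N N′ b (suc l) (suc b′) l′ p)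
grid-map u s s′ N N′ b (suc l) b′ (suc l′) (q ∷ p)
  with row-map u (runs-separated (s b) 0 N) (runs-separated (s′ b′) 0 N′) q
... | g₀ , row₀ = record
  { rowOf = λ k → proj₁ (image k) ; posOf = λ k → proj₂ (image k)
  ; above = above⁺ ; row-mono = mono⁺ ; row = row⁺ }
  where
  open GridMap (grid-map u s s′ N N′ (suc b) l (suc b′) l′ p)
  image : ℕ → ℕ × (ℕ → ℕ)
  image k = if does (k ≟ b) then (b′ , g₀) else (rowOf k , posOf k)
  image-first : image b ≡ (b′ , g₀)
  image-first rewrite dec-true (b ≟ b) refl = refl
  image-rest : ∀ {k} → b < k → image k ≡ (rowOf k , posOf k)
  image-rest {k} b<k rewrite dec-false (k ≟ b) (>⇒≢ b<k) = refl
  end : ∀ {k} → k < b + suc l → k < suc b + l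
  end {k} = subst (k <_) (+-suc b l)
  above⁺ : ∀ {k} → b ≤ k → k < b + suc l → b′ ≤ proj₁ (image k)
  above⁺ b≤k k< with m≤n⇒m<n∨m≡n b≤k
  ... | inj₂ refl rewrite image-first = ≤-refl
  ... | inj₁ b<k rewrite image-rest b<k = <⇒≤ (above b<k (end k<))
  mono⁺ : ∀ {k k′} → b ≤ k → k < k′ → k′ < b + suc l → proj₁ (image k) < proj₁ (image k′)
  mono⁺ b≤k k<k′ k′< with m≤n⇒m<n∨m≡n b≤k
  ... | inj₂ refl rewrite image-first | image-rest k<k′ = above k<k′ (end k′<)
  ... | inj₁ b<k rewrite image-rest b<k | image-rest (<-trans b<k k<k′) = row-mono b<k k<k′ (end k′<)
  row⁺ : ∀ {k} → b ≤ k → k < b + suc l →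
         RowMap u (proj₂ (image k)) (runs (s k) 0 N) (runs (s′ (proj₁ (image k))) 0 N′)
  row⁺ b≤k k< with m≤n⇒m<n∨m≡n b≤k
  ... | inj₂ refl rewrite image-first = row₀
  ... | inj₁ b<k rewrite image-rest b<k = row b<k (end k<)

bounded : ∀ {n} (f : Fin n → ℕ) → ∃ λ N → ∀ t → f t < N
bounded {zero}  f = 0 , λ ()
bounded {suc n} f with bounded (f ∘ fsuc)
... | N , f< = suc (f fzero) ⊔ N , λ where
  fzero    → m≤m⊔n (suc (f fzero)) N
  (fsuc t) → m≤n⇒m≤o⊔n (suc (f fzero)) (f< t)

module _ (u : ℕ → Bool) where

  module Code {n} (F : FinGraph n) (e : finToGraph F ↪ grid u) where
    occupied? : ∀ k i → Dec (∃ λ t → map e t ≡ (k , i))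
    occupied? k i = any? (λ t → ≡-dec _≟_ _≟_ (map e t) (k , i))

    occupied : ℕ → ℕ → Bool
    occupied k i = does (occupied? k i)

    preimage : ∀ {k i} → occupied k i ≡ true → ∃ λ t → map e t ≡ (k , i)
    preimage {k} {i} eq with occupied? k i
    ... | yes p = p
    preimage () | no _

    height width : ∃ λ N → ∀ t → _
    height = bounded (proj₁ ∘ map e)
    width  = bounded (proj₂ ∘ map e)

    code : List (List Segment)
    code = rows occupied (proj₁ width) 0 (proj₁ height)

    in-row : ∀ t → proj₂ (map e t) ∈ˡ runs (occupied (proj₁ (map e t))) 0 (proj₁ width)
    in-row t = runs-complete _ 0 (proj₁ width) z≤n (proj₂ width t)
      (dec-true (occupied? (proj₁ (map e t)) (proj₂ (map e t))) (t , refl))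

  -- The segments of a code cover exactly the occupied cells, so every image cell is occupied by a
  -- vertex of `F′`, found by `preimage`.
  code-embeds : ∀ {n n′} (F : FinGraph n) (F′ : FinGraph n′)
    (e : finToGraph F ↪ grid u) (e′ : finToGraph F′ ↪ grid u) →
    Sublist (Sublist (Factor u)) (Code.code F e) (Code.code F′ e′) → finToGraph F ↪ finToGraph F′
  code-embeds {n} {n′} F F′ e e′ p = record { map = proj₁ ∘ target ; inj = injective ; pres = preserves }
    where
    module C = Code F e
    module C′ = Code F′ e′
    open GridMap (grid-map u C.occupied C′.occupied (proj₁ C.width) (proj₁ C′.width)
                             0 (proj₁ C.height) 0 (proj₁ C′.height) p)

    k i : Fin n → ℕ
    k = proj₁ ∘ map e
    i = proj₂ ∘ map e

    row-at : ∀ t → RowMap u (posOf (k t)) (runs (C.occupied (k t)) 0 (proj₁ C.width))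
                             (runs (C′.occupied (rowOf (k t))) 0 (proj₁ C′.width))
    row-at t = row z≤n (proj₂ C.height t)

    target : ∀ t → ∃ λ t′ → map e′ t′ ≡ (rowOf (k t) , posOf (k t) (i t))
    target t = C′.preimage (runs-sound (C′.occupied (rowOf (k t))) 0 (proj₁ C′.width)
      (RowMap.member (row-at t) (C.in-row t)))

    rowOf-injective : ∀ t t′ → rowOf (k t) ≡ rowOf (k t′) → k t ≡ k t′
    rowOf-injective t t′ eq with <-cmp (k t) (k t′)
    ... | tri< lt _ _ = contradiction eq (<⇒≢ (row-mono z≤n lt (proj₂ C.height t′)))
    ... | tri≈ _ eq′ _ = eq′
    ... | tri> _ _ gt = contradiction (≡.sym eq) (<⇒≢ (row-mono z≤n gt (proj₂ C.height t)))

    in-row-of : ∀ {t k₀} → k t ≡ k₀ → i t ∈ˡ runs (C.occupied k₀) 0 (proj₁ C.width)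
    in-row-of {t} refl = C.in-row t

    posOf-injective : ∀ t t′ → k t ≡ k t′ → posOf (k t) (i t) ≡ posOf (k t) (i t′) → i t ≡ i t′
    posOf-injective t t′ k≡ eq with <-cmp (i t) (i t′)
    ... | tri< lt _ _ = contradiction eq (<⇒≢ (RowMap.mono (row-at t) (C.in-row t) (in-row-of (≡.sym k≡)) lt))
    ... | tri≈ _ eq′ _ = eq′
    ... | tri> _ _ gt = contradiction (≡.sym eq) (<⇒≢ (RowMap.mono (row-at t) (in-row-of (≡.sym k≡)) (C.in-row t) gt))

    injective : ∀ t t′ → proj₁ (target t) ≡ proj₁ (target t′) → t ≡ t′
    injective t t′ eq = inj e t t′ (cong₂ _,_ k≡ (posOf-injective t t′ k≡
      (trans (cong proj₂ same) (cong (λ k → posOf k (i t′)) (≡.sym k≡)))))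
      where
      same : _≡_ {A = ℕ × ℕ} (rowOf (k t) , posOf (k t) (i t)) (rowOf (k t′) , posOf (k t′) (i t′))
      same = trans (≡.sym (proj₂ (target t))) (trans (cong (map e′) eq) (proj₂ (target t′)))
      k≡ : k t ≡ k t′
      k≡ = rowOf-injective t t′ (cong proj₁ same)

    near-posOf : ∀ t t′ → k t ≡ k t′ → near (posOf (k t) (i t)) (posOf (k t) (i t′)) ≡ near (i t) (i t′)
    near-posOf t t′ k≡ with <-cmp (i t) (i t′)
    ... | tri< lt _ _ = RowMap.near-≡ (row-at t) (C.in-row t) (in-row-of (≡.sym k≡)) lt
    ... | tri≈ _ eq _ = trans (cong (near _) (cong (posOf (k t)) (≡.sym eq)))
      (trans (near-irrefl (posOf (k t) (i t))) (trans (≡.sym (near-irrefl (i t))) (cong (near (i t)) eq)))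
    ... | tri> _ _ gt = trans (near-sym (posOf (k t) (i t)) (posOf (k t) (i t′)))
      (trans (RowMap.near-≡ (row-at t) (in-row-of (≡.sym k≡)) (C.in-row t) gt) (near-sym (i t′) (i t)))

    preserves-cell : ∀ t t′ → cellE u (rowOf (k t) , posOf (k t) (i t)) (rowOf (k t′) , posOf (k t′) (i t′))
                            ≡ cellE u (k t , i t) (k t′ , i t′)
    preserves-cell t t′ with k t ≟ k t′
    ... | yes k≡ = begin
      cellE u (rowOf (k t) , posOf (k t) (i t)) (rowOf (k t′) , posOf (k t′) (i t′))
        ≡⟨ cong (λ x → cellE u (rowOf (k t) , posOf (k t) (i t)) (rowOf x , posOf x (i t′))) k≡ ⟨
      cellE u (rowOf (k t) , posOf (k t) (i t)) (rowOf (k t) , posOf (k t) (i t′))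
        ≡⟨ cellE-same u (rowOf (k t)) {posOf (k t) (i t)} {posOf (k t) (i t′)} ⟩
      near (posOf (k t) (i t)) (posOf (k t) (i t′)) ≡⟨ near-posOf t t′ k≡ ⟩
      near (i t) (i t′) ≡⟨ cellE-same u (k t) {i t} {i t′} ⟨
      cellE u (k t , i t) (k t , i t′) ≡⟨ cong (λ x → cellE u (k t , i t) (x , i t′)) k≡ ⟩
      cellE u (k t , i t) (k t′ , i t′) ∎
      where open ≡-Reasoning
    ... | no k≢ = trans (cellE-diff u _ _ (k≢ ∘ rowOf-injective t t′))
      (trans (cong₂ _∧_ (RowMap.letter-≡ (row-at t) (C.in-row t)) (RowMap.letter-≡ (row-at t′) (C.in-row t′)))
             (≡.sym (cellE-diff u (i t) (i t′) k≢)))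

    preserves : ∀ t t′ → FinGraph.adj F′ (proj₁ (target t)) (proj₁ (target t′)) ≡ FinGraph.adj F t t′
    preserves t t′ = trans (≡.sym (pres e′ (proj₁ (target t)) (proj₁ (target t′))))
      (trans (cong₂ (cellE u) (proj₂ (target t)) (proj₂ (target t′)))
      (trans (preserves-cell t t′) (pres e t t′)))

  triangle-wqo : Recurrent u → AgeWQO (triangle u)
  triangle-wqo recurrent (A , inAge , antichain) = conclude (af-good
    (higman (sublist? (factor? u)) (higman (factor? u) (af-factor u recurrent)))
    (λ i → Code.code (proj₂ (A i)) (in-grid i)))
    where
    in-grid : ∀ i → finToGraph (proj₂ (A i)) ↪ grid u
    in-grid i = ↪-trans (inAge i) (triangle↪grid u)
    conclude : ¬ (∃₂ λ i j → i < j × Sublist (Sublist (Factor u))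
      (Code.code (proj₂ (A i)) (in-grid i)) (Code.code (proj₂ (A j)) (in-grid j)))
    conclude (i , j , i<j , p) = antichain i j (<⇒≢ i<j)
      (code-embeds (proj₂ (A i)) (proj₂ (A j)) (in-grid i) (in-grid j) p)

theorem10 : Σ ((ℕ → Bool) → Graph) λ G →
    (∀ a → PathMinimal (G a) × Prime (G a) × AgeWQO (G a))
    × (∀ a b → ¬ (∀ n → a n ≡ b n) →
    ¬ AgeSubset (G a) (G b) × ¬ AgeSubset (G b) (G a))
theorem10 = (λ a → triangle (toeplitz (levels a))) ,
  (λ a → triangle-minimal (dense a) (toeplitz-recurrent (levels a)) ,
         triangle-prime refl refl (isolated a) ,
         triangle-wqo (toeplitz (levels a)) (toeplitz-recurrent (levels a))) ,
  λ a b a≢b → a≢b ∘ age-≗ a b , λ b⊆a → a≢b (≡.sym ∘ age-≗ b a b⊆a)
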